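{- Let $p$ be an odd prime. Let $\sigma$ and $\delta$ be the permutations of $\mathbb{F}_p$ induced by $x\mapsto x+1$ and $x\mapsto x^{p-2}$ respectively. Let $G$ be the subgroup of the symmetric group on $\mathbb{F}_p$ generated by all permutations $x\mapsto x^d+c$, where $c\in\mathbb{F}_p$ and $d$ ranges over the integers with $1\le d<p-1$ and $\gcd(d,p-1)=1$. Then \[ \langle \sigma,\delta\rangle = G \cong \begin{cases} S_p & \text{if } p\equiv 1 \pmod 4,\\ A_p & \text{if } p\equiv 3 \pmod 4, \end{cases} \] where $S_p$ and $A_p$ denote the symmetric and alternating groups on the $p$ elements of $\mathbb{F}_p$.
   Context: For $\gcd(d,p-1)=1$ the map $x\mapsto x^d+c$ is a bijection of $\mathbb{F}_p$. Groups of permutations are taken with composition of functions. -}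

module Defs where

open import Data.Nat using (ℕ; zero; suc; _+_; _*_; _∸_; _^_; _<_; _≤_; _<ᵇ_; NonZero)
open import Data.Nat.DivMod using (_mod_)
open import Data.Nat.GCD using (gcd)
open import Data.Nat.Divisibility using (_∣_)
open import Data.Bool using (if_then_else_; _∧_)
open import Data.Fin using (Fin; toℕ)
open import Data.List using (map; allFin)
open import Data.Nat.ListAction using (sum)
open import Data.Fin.Permutation using (Permutation′; _⟨$⟩ʳ_; id; flip; _∘ₚ_)
open import Data.Product using (Σ; _×_)
open import Data.Sum using (_⊎_)
open import Relation.Binary.PropositionalEquality using (_≡_)

-- We model 𝔽_p as Fin p, with element x corresponding to the residue toℕ x.
-- The permutation group Sym(𝔽_p) is Permutation′ p (bijections Fin p ↔ Fin p),
-- with composition _∘ₚ_, identity id and inverse flip.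

data ⟨_⟩ {n : ℕ} (S : Permutation′ n → Set) : Permutation′ n → Set where
  gen : ∀ {π} → S π → ⟨ S ⟩ π
  one : ⟨ S ⟩ id
  mul : ∀ {π ρ} → ⟨ S ⟩ π → ⟨ S ⟩ ρ → ⟨ S ⟩ (π ∘ₚ ρ)
  inv : ∀ {π} → ⟨ S ⟩ π → ⟨ S ⟩ (flip π)
  ext : ∀ {π ρ} → (∀ i → π ⟨$⟩ʳ i ≡ ρ ⟨$⟩ʳ i) → ⟨ S ⟩ π → ⟨ S ⟩ ρ

IsSigma : (p : ℕ) .{{_ : NonZero p}} → Permutation′ p → Set
IsSigma p π = ∀ x → π ⟨$⟩ʳ x ≡ (toℕ x + 1) mod p

IsDelta : (p : ℕ) .{{_ : NonZero p}} → Permutation′ p → Set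
IsDelta p π = ∀ x → π ⟨$⟩ʳ x ≡ (toℕ x ^ (p ∸ 2)) mod p

SigmaDelta : (p : ℕ) .{{_ : NonZero p}} → Permutation′ p → Set
SigmaDelta p π = IsSigma p π ⊎ IsDelta p π

PowerShift : (p : ℕ) .{{_ : NonZero p}} → Permutation′ p → Set
PowerShift p π = Σ ℕ λ d → Σ (Fin p) λ c →
  (1 ≤ d) × (d < p ∸ 1) × (gcd d (p ∸ 1) ≡ 1) ×
  (∀ x → π ⟨$⟩ʳ x ≡ (toℕ x ^ d + toℕ c) mod p)

inversions : {n : ℕ} → Permutation′ n → ℕ
inversions {n} π = sum (map (λ i → sum (map (λ j →
  if (toℕ i <ᵇ toℕ j) ∧ (toℕ (π ⟨$⟩ʳ j) <ᵇ toℕ (π ⟨$⟩ʳ i)) then 1 else 0)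
  (allFin n))) (allFin n))

Even : {n : ℕ} → Permutation′ n → Set
Even π = 2 ∣ inversions π

{-# OPTIONS --safe #-}

-- Write σ(x) = x + 1 and δ(x) = x^(p-2), which is 1/x for x ≠ 0. The word x ↦ δ(δ(δ(x+1)-1)+1) is
-- x ↦ -x preceded by the transposition (0 -1), so its square is the 3-cycle (0 -1)(0 1). Call two
-- transpositions equivalent if their product is an even element of ⟨σ,δ⟩. Conjugation by shifts
-- turns this 3-cycle into the equivalence of all transpositions, whence ⟨σ,δ⟩ contains every
-- even permutation. If p ≡ 1 (mod 4), then x ↦ -x is even, so (0 -1) itself lies in ⟨σ,δ⟩.
-- If p ≡ 3 (mod 4), every generator of G is even: a shift is a square, and x ↦ x^d preserves
-- Q = {x : x^((p-1)/2) = 1} and commutes with x ↦ -x, which exchanges Q with the other nonzero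
-- elements, so it is the product of its restriction to Q and a conjugate of that restriction.
module Submission where

open import Defs
open import Data.Nat using (ℕ; _%_; NonZero)
open import Data.Nat.Primality using (Prime)
open import Data.Fin.Permutation using (Permutation′)
open import Data.Product using (_×_)
open import Function.Bundles using (_⇔_)
open import Relation.Binary.PropositionalEquality using (_≡_; _≢_)

open import Algebra.Bundles using (CommutativeRing)
import Algebra.Properties.CommutativeMonoid.Sum
import Algebra.Properties.CommutativeSemiring.Binomial
import Algebra.Properties.CommutativeSemiring.Exp
import Algebra.Properties.Ring
import Algebra.Properties.Semiring.Mult
open import Data.Bool using (Bool; true; false; not; _∧_; _xor_; if_then_else_)
open import Data.Bool.Properties using (T-≡; xor-annihilates-not)
open import Data.Fin using (Fin; zero; suc; toℕ; opposite; inject₁; fromℕ)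
open import Data.Fin.Permutation
  using (_⟨$⟩ʳ_; _⟨$⟩ˡ_; id; flip; _∘ₚ_; transpose; reverse; inverseˡ; inverseʳ; permutation)
open import Data.Fin.Permutation.Transposition.List using (eval; decompose; eval-decompose)
open import Data.Fin.Properties
  using (_≟_; toℕ-injective; toℕ<n; opposite-prop; toℕ-fromℕ<; toℕ-fromℕ; toℕ-inject₁)
open import Data.List using ([]; _∷_; allFin; map; tabulate)
open import Data.List.Properties using (map-tabulate)
open import Data.Nat using (zero; suc; _+_; _*_; _∸_; _^_; _/_; _!; _<_; _<ᵇ_; z≤n; s≤s; parity;
  >-nonZero; >-nonZero⁻¹; ≢-nonZero⁻¹; nonTrivial⇒n>1)
open import Data.Nat.Combinatorics using (_C_; nCn≡1; k![n∸k]!∣n!)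
open import Data.Nat.Combinatorics.Specification using (nCk≡n!/k![n-k]!)
open import Data.Nat.Coprimality as Coprime using (Coprime; coprime⇒gcd≡1; coprime-+; 1-coprimeTo)
open import Data.Nat.Divisibility
  using (_∣_; divides; n∣m⇒m%n≡0; m%n≡0⇒n∣m; ∣⇒≤; >⇒∤; m∣m*n)
open import Data.Nat.DivMod
  using (_mod_; m%n<n; m<n⇒m%n≡m; n%n≡0; m≡m%n+[m/n]*n; m/n*n≡m; %-distribˡ-+; %-distribˡ-*)
open import Data.Nat.GCD using (gcd; gcd-greatest)
open import Data.Nat.ListAction using () renaming (sum to sumₗ)
open import Data.Nat.Primality using (euclidsLemma; prime⇒nonTrivial; prime⇒irreducible)
import Data.Nat.Properties as ℕ
open import Data.Nat.Solver using (module +-*-Solver)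
open import Data.Parity using (Parity; 0ℙ; 1ℙ) renaming (_+_ to _+ℙ_)
import Data.Parity.Properties as ℙ
open import Data.Product using (_,_; ∃; proj₁; proj₂)
open import Data.Sum using (_⊎_; inj₁; inj₂)
open import Function using (_∘_; case_of_)
open import Function.Bundles using (Equivalence; Injection; mk⇔)
open import Function.Properties.Inverse using (↔⇒↣)
open import Level using (0ℓ)
open import Relation.Binary.PropositionalEquality
  using (refl; sym; trans; cong; cong₂; subst; subst₂; isEquivalence; module ≡-Reasoning)
open import Relation.Nullary using (¬_; Dec; yes; no; contradiction)
open import Relation.Nullary.Decidable using (dec-true; dec-false)

open import Algebra.Properties.CommutativeMonoid.Sum ℕ.+-0-commutativeMonoid
  using (∑-permute; ∑-distrib-+; ∑-comm; sum-cong-≗; sum-replicate-zero; sum-syntax)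
  renaming (sum to ∑)
open import Algebra.Properties.CommutativeSemigroup ℕ.+-commutativeSemigroup using (interchange)
open +-*-Solver using (solve; _:+_; _:*_; _:=_; con)

private variable n : ℕ

-- Parity of permutations

⟦_⟧ : Bool → ℕ
⟦ b ⟧ = if b then 1 else 0

_<ᶠ_ : Fin n → Fin n → Bool
i <ᶠ j = toℕ i <ᵇ toℕ j

sum-tabulate : (f : Fin n → ℕ) → sumₗ (tabulate f) ≡ ∑ f
sum-tabulate {zero}  f = refl
sum-tabulate {suc n} f = cong (f zero +_) (sum-tabulate (f ∘ suc))

sum-allFin : (f : Fin n → ℕ) → sumₗ (map f (allFin n)) ≡ ∑ f
sum-allFin f = trans (cong sumₗ (map-tabulate (λ i → i) f)) (sum-tabulate f)

-- Passes from list sums to sums over `Fin n`, for which reindexing by a permutation and interchange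
-- of summation are available.
inversions-∑ : (π : Permutation′ n) → inversions π ≡
  ∑[ i < n ] ∑[ j < n ] ⟦ i <ᶠ j ∧ (π ⟨$⟩ʳ j) <ᶠ (π ⟨$⟩ʳ i) ⟧
inversions-∑ {n} π = trans (sum-allFin row) (sum-cong-≗ λ i → sum-allFin (entry i))
  where
  entry : Fin n → Fin n → ℕ
  entry i j = ⟦ i <ᶠ j ∧ (π ⟨$⟩ʳ j) <ᶠ (π ⟨$⟩ʳ i) ⟧
  row : Fin n → ℕ
  row i = sumₗ (map (entry i) (allFin n))

<ᵇ-irrefl : ∀ m → (m <ᵇ m) ≡ false
<ᵇ-irrefl zero    = refl
<ᵇ-irrefl (suc m) = <ᵇ-irrefl m

<ᵇ-flip : ∀ m n → m ≢ n → (n <ᵇ m) ≡ not (m <ᵇ n)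
<ᵇ-flip zero    zero    m≢n = contradiction refl m≢n
<ᵇ-flip zero    (suc n) m≢n = refl
<ᵇ-flip (suc m) zero    m≢n = refl
<ᵇ-flip (suc m) (suc n) m≢n = <ᵇ-flip m n (m≢n ∘ cong suc)

<ᶠ-flip : {i j : Fin n} → i ≢ j → (j <ᶠ i) ≡ not (i <ᶠ j)
<ᶠ-flip i≢j = <ᵇ-flip _ _ (i≢j ∘ toℕ-injective)

permutation-injective : (π : Permutation′ n) {i j : Fin n} → π ⟨$⟩ʳ i ≡ π ⟨$⟩ʳ j → i ≡ j
permutation-injective π = Injection.injective (↔⇒↣ π)

-- Off the diagonal exactly one of `i <ᶠ j` and `j <ᶠ i` holds, so each unordered pair is met twice.
∑-symmetric : (f : Fin n → Fin n → ℕ) → (∀ i → f i i ≡ 0) → (∀ i j → f i j ≡ f j i) →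
  ∑[ i < n ] ∑[ j < n ] f i j ≡
  ∑[ i < n ] ∑[ j < n ] (if i <ᶠ j then f i j else 0) + ∑[ i < n ] ∑[ j < n ] (if i <ᶠ j then f i j else 0)
∑-symmetric {n} f f-diag f-sym = begin
  ∑[ i < n ] ∑[ j < n ] f i j                  ≡⟨ sum-cong-≗ (λ i → sum-cong-≗ (split i)) ⟩
  ∑[ i < n ] ∑[ j < n ] (g i j + g j i)        ≡⟨ sum-cong-≗ (λ i → ∑-distrib-+ (g i) (λ j → g j i)) ⟩
  ∑[ i < n ] (∑[ j < n ] g i j + ∑[ j < n ] g j i)
    ≡⟨ ∑-distrib-+ (λ i → ∑[ j < n ] g i j) (λ i → ∑[ j < n ] g j i) ⟩
  ∑[ i < n ] ∑[ j < n ] g i j + ∑[ i < n ] ∑[ j < n ] g j i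
    ≡⟨ cong (∑[ i < n ] ∑[ j < n ] g i j +_) (∑-comm (λ i j → g j i)) ⟩
  ∑[ i < n ] ∑[ j < n ] g i j + ∑[ i < n ] ∑[ j < n ] g i j ∎
  where
  open ≡-Reasoning
  g : Fin n → Fin n → ℕ
  g i j = if i <ᶠ j then f i j else 0
  split : ∀ i j → f i j ≡ g i j + g j i
  split i j with i ≟ j
  ... | yes refl rewrite <ᵇ-irrefl (toℕ i) = f-diag i
  ... | no i≢j rewrite <ᶠ-flip i≢j with i <ᶠ j
  ... | true  = sym (ℕ.+-identityʳ _)
  ... | false = f-sym i j

-- Unlike an inversion, a discordant pair is unordered, so that summing over all pairs is
-- invariant under reindexing by a permutation.
discordance : (Fin n → Fin n) → Fin n → Fin n → ℕ
discordance f i j = ⟦ i <ᶠ j xor f i <ᶠ f j ⟧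

discordance-diag : (f : Fin n → Fin n) → ∀ i → discordance f i i ≡ 0
discordance-diag f i rewrite <ᵇ-irrefl (toℕ i) | <ᵇ-irrefl (toℕ (f i)) = refl

discordance-sym : (π : Permutation′ n) → ∀ i j →
  discordance (π ⟨$⟩ʳ_) i j ≡ discordance (π ⟨$⟩ʳ_) j i
discordance-sym π i j with i ≟ j
... | yes refl = refl
... | no i≢j rewrite <ᶠ-flip i≢j | <ᶠ-flip (i≢j ∘ permutation-injective π) =
  cong ⟦_⟧ (sym (xor-annihilates-not (i <ᶠ j) _))

-- For `i <ᶠ j` a discordant pair is precisely an inversion, and `∑-symmetric` then accounts for the
-- factor 2.
double-inversions : (π : Permutation′ n) →
  inversions π + inversions π ≡ ∑[ i < n ] ∑[ j < n ] discordance (π ⟨$⟩ʳ_) i j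
double-inversions {n} π = sym (trans
  (∑-symmetric (discordance (π ⟨$⟩ʳ_)) (discordance-diag (π ⟨$⟩ʳ_)) (discordance-sym π))
  (cong₂ _+_ lower≡inversions lower≡inversions))
  where
  entry : ∀ i j → (if i <ᶠ j then discordance (π ⟨$⟩ʳ_) i j else 0) ≡
                  ⟦ i <ᶠ j ∧ (π ⟨$⟩ʳ j) <ᶠ (π ⟨$⟩ʳ i) ⟧
  entry i j with i ≟ j
  ... | yes refl rewrite <ᵇ-irrefl (toℕ i) = refl
  ... | no i≢j rewrite <ᶠ-flip (i≢j ∘ permutation-injective π) with i <ᶠ j
  ... | true  = refl
  ... | false = refl
  lower≡inversions = trans (sum-cong-≗ λ i → sum-cong-≗ (entry i)) (sym (inversions-∑ π))

-- Addition modulo 2 lifted to ℕ: the sum of two bits exceeds their xor by twice their product. The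
-- correction stands on the left to avoid subtraction.
xor-cocycle : ∀ a b c → ⟦ a xor c ⟧ + (⟦ a xor b ⟧ * ⟦ b xor c ⟧ + ⟦ a xor b ⟧ * ⟦ b xor c ⟧)
                      ≡ ⟦ a xor b ⟧ + ⟦ b xor c ⟧
xor-cocycle true  true  true  = refl
xor-cocycle true  true  false = refl
xor-cocycle true  false true  = refl
xor-cocycle true  false false = refl
xor-cocycle false true  true  = refl
xor-cocycle false true  false = refl
xor-cocycle false false true  = refl
xor-cocycle false false false = refl

∑∑-distrib-+ : (f g : Fin n → Fin n → ℕ) →
  ∑[ i < n ] ∑[ j < n ] (f i j + g i j) ≡ ∑[ i < n ] ∑[ j < n ] f i j + ∑[ i < n ] ∑[ j < n ] g i j
∑∑-distrib-+ {n} f g = trans (sum-cong-≗ λ i → ∑-distrib-+ (f i) (g i))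
  (∑-distrib-+ (λ i → ∑[ j < n ] f i j) (λ i → ∑[ j < n ] g i j))

m+m-injective : ∀ {a b} → a + a ≡ b + b → a ≡ b
m+m-injective {a} {b} eq = ℕ.*-cancelˡ-≡ a b 2
  (subst₂ (λ c d → a + c ≡ b + d) (sym (ℕ.+-identityʳ a)) (sym (ℕ.+-identityʳ b)) eq)

-- `xor-cocycle` is summed over all pairs, comparing the order of `i`, `j` with that of their images
-- under `π` and under `π ∘ₚ ρ`. The equation is proved doubled and then halved.
inversions-∘ : (π ρ : Permutation′ n) →
  ∃ λ w → inversions (π ∘ₚ ρ) + (w + w) ≡ inversions π + inversions ρ
inversions-∘ {n} π ρ = w , m+m-injective (begin
  (inversions (π ∘ₚ ρ) + (w + w)) + (inversions (π ∘ₚ ρ) + (w + w))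
    ≡⟨ interchange (inversions (π ∘ₚ ρ)) (w + w) _ _ ⟩
  (inversions (π ∘ₚ ρ) + inversions (π ∘ₚ ρ)) + ((w + w) + (w + w))
    ≡⟨ cong₂ _+_ (double-inversions (π ∘ₚ ρ)) (cong₂ _+_ (sym ∑∑f) (sym ∑∑f)) ⟩
  ∑∑ (discordance (ρʳ ∘ πʳ)) + (∑∑ f + ∑∑ f)
    ≡⟨ cong (∑∑ (discordance (ρʳ ∘ πʳ)) +_) (∑∑-distrib-+ f f) ⟨
  ∑∑ (discordance (ρʳ ∘ πʳ)) + ∑∑ (λ i j → f i j + f i j)
    ≡⟨ ∑∑-distrib-+ (discordance (ρʳ ∘ πʳ)) _ ⟨
  ∑∑ (λ i j → discordance (ρʳ ∘ πʳ) i j + (f i j + f i j))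
    ≡⟨ sum-cong-≗ (λ i → sum-cong-≗ λ j → xor-cocycle (i <ᶠ j) (πʳ i <ᶠ πʳ j) _) ⟩
  ∑∑ (λ i j → discordance πʳ i j + discordance ρʳ (πʳ i) (πʳ j))
    ≡⟨ ∑∑-distrib-+ (discordance πʳ) (λ i j → discordance ρʳ (πʳ i) (πʳ j)) ⟩
  ∑∑ (discordance πʳ) + ∑∑ (λ i j → discordance ρʳ (πʳ i) (πʳ j))
    ≡⟨ cong (∑∑ (discordance πʳ) +_) reindex ⟩
  ∑∑ (discordance πʳ) + ∑∑ (discordance ρʳ)
    ≡⟨ cong₂ _+_ (double-inversions π) (double-inversions ρ) ⟨
  (inversions π + inversions π) + (inversions ρ + inversions ρ)
    ≡⟨ interchange (inversions π) _ _ _ ⟩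
  (inversions π + inversions ρ) + (inversions π + inversions ρ) ∎)
  where
  open ≡-Reasoning
  πʳ = π ⟨$⟩ʳ_
  ρʳ = ρ ⟨$⟩ʳ_
  ∑∑ : (Fin n → Fin n → ℕ) → ℕ
  ∑∑ h = ∑[ i < n ] ∑[ j < n ] h i j
  f : Fin n → Fin n → ℕ
  f i j = discordance πʳ i j * discordance ρʳ (πʳ i) (πʳ j)
  -- Since `f` is symmetric and zero on the diagonal, its full sum is `w + w`. The correction in the
  -- doubled equation is therefore four times `w`, and it is still even after halving.
  w = ∑∑ (λ i j → if i <ᶠ j then f i j else 0)
  ∑∑f : ∑∑ f ≡ w + w
  ∑∑f = ∑-symmetric f
    (λ i → cong (_* discordance ρʳ (πʳ i) (πʳ i)) (discordance-diag πʳ i))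
    (λ i j → cong₂ _*_ (discordance-sym π i j) (discordance-sym ρ (πʳ i) (πʳ j)))
  reindex : ∑∑ (λ i j → discordance ρʳ (πʳ i) (πʳ j)) ≡ ∑∑ (discordance ρʳ)
  reindex = sym (trans (∑-permute _ π) (sum-cong-≗ λ i → ∑-permute (discordance ρʳ (πʳ i)) π))

sgn : Permutation′ n → Parity
sgn π = parity (inversions π)

parity-double : ∀ w → parity (w + w) ≡ 0ℙ
parity-double w = trans (ℙ.+-homo-+ w w) (ℙ.p+p≡0ℙ (parity w))

sgn-∘ : (π ρ : Permutation′ n) → sgn (π ∘ₚ ρ) ≡ sgn π +ℙ sgn ρ
sgn-∘ π ρ with w , eq ← inversions-∘ π ρ = begin
  parity (inversions (π ∘ₚ ρ))                       ≡⟨ ℙ.+-identityʳ _ ⟨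
  parity (inversions (π ∘ₚ ρ)) +ℙ 0ℙ                 ≡⟨ cong (sgn (π ∘ₚ ρ) +ℙ_) (parity-double w) ⟨
  parity (inversions (π ∘ₚ ρ)) +ℙ parity (w + w)     ≡⟨ ℙ.+-homo-+ (inversions (π ∘ₚ ρ)) (w + w) ⟨
  parity (inversions (π ∘ₚ ρ) + (w + w))             ≡⟨ cong parity eq ⟩
  parity (inversions π + inversions ρ)               ≡⟨ ℙ.+-homo-+ (inversions π) (inversions ρ) ⟩
  sgn π +ℙ sgn ρ                                     ∎
  where open ≡-Reasoning

sgn-cong : {π ρ : Permutation′ n} → (∀ i → π ⟨$⟩ʳ i ≡ ρ ⟨$⟩ʳ i) → sgn π ≡ sgn ρ
sgn-cong {π = π} {ρ} π≈ρ = cong parity (trans (inversions-∑ π) (trans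
  (sum-cong-≗ λ i → sum-cong-≗ λ j → cong₂ (λ a b → ⟦ i <ᶠ j ∧ a <ᶠ b ⟧) (π≈ρ j) (π≈ρ i))
  (sym (inversions-∑ ρ))))

sgn-id : sgn (id {n}) ≡ 0ℙ
sgn-id {n} = begin
  sgn 1ₙ             ≡⟨ sgn-cong {π = 1ₙ} {1ₙ ∘ₚ 1ₙ} (λ _ → refl) ⟩
  sgn (1ₙ ∘ₚ 1ₙ)     ≡⟨ sgn-∘ 1ₙ 1ₙ ⟩
  sgn 1ₙ +ℙ sgn 1ₙ   ≡⟨ ℙ.p+p≡0ℙ (sgn 1ₙ) ⟩
  0ℙ                 ∎
  where
  open ≡-Reasoning
  1ₙ : Permutation′ n
  1ₙ = id

sgn-flip : (π : Permutation′ n) → sgn (flip π) ≡ sgn π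
sgn-flip {n} π = begin
  sgn (flip π)                       ≡⟨ ℙ.+-identityʳ _ ⟨
  sgn (flip π) +ℙ 0ℙ                 ≡⟨ cong (sgn (flip π) +ℙ_) (ℙ.p+p≡0ℙ (sgn π)) ⟨
  sgn (flip π) +ℙ (sgn π +ℙ sgn π)   ≡⟨ ℙ.+-assoc (sgn (flip π)) (sgn π) (sgn π) ⟨
  (sgn (flip π) +ℙ sgn π) +ℙ sgn π   ≡⟨ cong (_+ℙ sgn π) (sgn-∘ (flip π) π) ⟨
  sgn (flip π ∘ₚ π) +ℙ sgn π         ≡⟨ cong (_+ℙ sgn π) (trans (sgn-cong {π = flip π ∘ₚ π} {id {n}} λ _ → inverseʳ π) (sgn-id {n})) ⟩
  sgn π                              ∎
  where open ≡-Reasoning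

Even⇒sgn : {π : Permutation′ n} → Even π → sgn π ≡ 0ℙ
Even⇒sgn (divides q eq) = trans (cong parity eq) (trans (ℙ.*-homo-* q 2) (ℙ.*-zeroʳ (parity q)))

parity-0⇒2∣ : ∀ m → parity m ≡ 0ℙ → 2 ∣ m
parity-0⇒2∣ zero          eq = divides 0 refl
parity-0⇒2∣ (suc (suc m)) eq with divides q refl ← parity-0⇒2∣ m eq = divides (suc q) refl

sgn⇒Even : {π : Permutation′ n} → sgn π ≡ 0ℙ → Even π
sgn⇒Even = parity-0⇒2∣ _

-- Inversions of the transposition (0 1) and of the reversal

∑-zero : (f : Fin n → ℕ) → (∀ i → f i ≡ 0) → ∑ f ≡ 0
∑-zero {n} f f≡0 = trans (sum-cong-≗ f≡0) (sum-replicate-zero n)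

<ᵇ-asym : ∀ a b → (a <ᵇ b) ∧ (b <ᵇ a) ≡ false
<ᵇ-asym zero zero = refl
<ᵇ-asym zero (suc b) = refl
<ᵇ-asym (suc a) zero = refl
<ᵇ-asym (suc a) (suc b) = <ᵇ-asym a b

inversions-transpose-0-1 : inversions {suc (suc n)} (transpose zero (suc zero)) ≡ 1
inversions-transpose-0-1 {n} = trans (inversions-∑ {suc (suc n)} (transpose zero (suc zero)))
  (cong₂ _+_ (cong suc (∑-zero {n} _ λ _ → refl))
  (cong₂ _+_ (∑-zero {n} _ λ _ → refl)
  (∑-zero {n} _ λ i → ∑-zero {n} _ λ j → cong ⟦_⟧ (<ᵇ-asym (toℕ i) (toℕ j)))))

-- The points are specified through `toℕ` so that the lemma applies to `0 mod p` and `1 mod p`,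
-- which are not constructor forms when `p` is a variable.
sgn-transpose-0-1 : (i j : Fin n) → toℕ i ≡ 0 → toℕ j ≡ 1 → sgn (transpose i j) ≡ 1ℙ
sgn-transpose-0-1 {suc (suc n)} zero (suc zero) _ _ = cong parity (inversions-transpose-0-1 {n})

∑-one : ∀ n → ∑ {n} (λ _ → 1) ≡ n
∑-one zero    = refl
∑-one (suc n) = cong suc (∑-one n)

-- The binomial coefficient n choose 2, which is the number of inversions of `reverse`.
pairs : ℕ → ℕ
pairs n = ∑[ i < n ] ∑[ j < n ] ⟦ i <ᶠ j ⟧

pairs-suc : ∀ n → pairs (suc n) ≡ n + pairs n
pairs-suc n = cong (_+ pairs n) (∑-one n)

double-pairs : ∀ n → (pairs n + pairs n) + n ≡ n * n
double-pairs zero = refl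
double-pairs (suc n) = begin
  (pairs (suc n) + pairs (suc n)) + suc n  ≡⟨ cong (λ t → (t + t) + suc n) (pairs-suc n) ⟩
  ((n + pairs n) + (n + pairs n)) + suc n  ≡⟨ solve 2 (λ m t → ((m :+ t) :+ (m :+ t)) :+ (con 1 :+ m) := con 1 :+ (m :+ (m :+ ((t :+ t) :+ m)))) refl n (pairs n) ⟩
  suc (n + (n + ((pairs n + pairs n) + n))) ≡⟨ cong (λ t → suc (n + (n + t))) (double-pairs n) ⟩
  suc (n + (n + n * n))                    ≡⟨ cong (λ t → suc (n + t)) (ℕ.*-suc n n) ⟨
  suc (n + n * suc n)                      ∎
  where open ≡-Reasoning

opposite-<ᶠ : (i j : Fin n) → toℕ i < toℕ j → (opposite j <ᶠ opposite i) ≡ true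
opposite-<ᶠ {n} i j i<j rewrite opposite-prop i | opposite-prop j =
  Equivalence.to T-≡ (ℕ.<⇒<ᵇ (ℕ.∸-monoʳ-< (s≤s i<j) (toℕ<n j)))

inversions-reverse : ∀ n → inversions (reverse {n}) ≡ pairs n
inversions-reverse n = trans (inversions-∑ {n} reverse) (sum-cong-≗ λ i → sum-cong-≗ (entry i))
  where
  entry : (i j : Fin n) → ⟦ i <ᶠ j ∧ opposite j <ᶠ opposite i ⟧ ≡ ⟦ i <ᶠ j ⟧
  entry i j with toℕ i <ᵇ toℕ j in eq
  ... | false = refl
  ... | true  = cong ⟦_⟧ (opposite-<ᶠ i j (ℕ.<ᵇ⇒< _ _ (Equivalence.from T-≡ eq)))

-- With N = 4k + 1 the number of pairs is N(N - 1)/2 = 2kN.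
sgn-reverse : ∀ k → sgn (reverse {1 + k * 4}) ≡ 0ℙ
sgn-reverse k = begin
  parity (inversions (reverse {N}))   ≡⟨ cong parity (inversions-reverse N) ⟩
  parity (pairs N)           ≡⟨ cong parity (m+m-injective {pairs N} {k * N + k * N} (ℕ.+-cancelʳ-≡ N _ _ quadruple)) ⟩
  parity (k * N + k * N)     ≡⟨ parity-double (k * N) ⟩
  0ℙ                         ∎
  where
  open ≡-Reasoning
  N = 1 + k * 4
  quadruple : (pairs N + pairs N) + N ≡ ((k * N + k * N) + (k * N + k * N)) + N
  quadruple = trans (double-pairs N)
    (solve 1 (λ x → (con 1 :+ x :* con 4) :* (con 1 :+ x :* con 4) :=
      ((x :* (con 1 :+ x :* con 4) :+ x :* (con 1 :+ x :* con 4)) :+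
       (x :* (con 1 :+ x :* con 4) :+ x :* (con 1 :+ x :* con 4))) :+ (con 1 :+ x :* con 4)) refl k)

-- Transpositions

transpose-matchˡ : (i j : Fin n) → transpose i j ⟨$⟩ʳ i ≡ j
transpose-matchˡ i j rewrite dec-true (i ≟ i) refl = refl

transpose-matchʳ : (i j : Fin n) → transpose i j ⟨$⟩ʳ j ≡ i
transpose-matchʳ i j with j ≟ i
... | yes refl = refl
... | no j≢i rewrite dec-true (j ≟ j) refl = refl

transpose-mismatch : {i j k : Fin n} → k ≢ i → k ≢ j → transpose i j ⟨$⟩ʳ k ≡ k
transpose-mismatch {i = i} {j} {k} k≢i k≢j rewrite dec-false (k ≟ i) k≢i | dec-false (k ≟ j) k≢j = refl

transpose-comm : (i j k : Fin n) → transpose i j ⟨$⟩ʳ k ≡ transpose j i ⟨$⟩ʳ k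
transpose-comm i j k = by-cases (k ≟ i) (k ≟ j)
  where
  by-cases : Dec (k ≡ i) → Dec (k ≡ j) → transpose i j ⟨$⟩ʳ k ≡ transpose j i ⟨$⟩ʳ k
  by-cases (yes refl) _          = trans (transpose-matchˡ k j) (sym (transpose-matchʳ j k))
  by-cases (no _)     (yes refl) = trans (transpose-matchʳ i k) (sym (transpose-matchˡ k i))
  by-cases (no k≢i)   (no k≢j)   = trans (transpose-mismatch k≢i k≢j) (sym (transpose-mismatch k≢j k≢i))

-- The inverse built into `transpose i j` is `transpose j i`, so `transpose-comm` reduces the claim
-- to the inverse law.
transpose-involutive : (i j k : Fin n) → transpose i j ⟨$⟩ʳ (transpose i j ⟨$⟩ʳ k) ≡ k
transpose-involutive i j k = trans (transpose-comm i j (transpose i j ⟨$⟩ʳ k)) (inverseˡ (transpose i j) {k})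

transpose-refl : (i k : Fin n) → transpose i i ⟨$⟩ʳ k ≡ k
transpose-refl i k with k ≟ i
... | yes refl = refl
... | no k≢i rewrite dec-false (k ≟ i) k≢i = refl

-- The usual formula for the conjugate of a transposition, in a form free of inverses. It is applied
-- to shifts, to transpositions and to negation.
transpose-conj : (π : Permutation′ n) (i j k : Fin n) →
  π ⟨$⟩ʳ (transpose i j ⟨$⟩ʳ k) ≡ transpose (π ⟨$⟩ʳ i) (π ⟨$⟩ʳ j) ⟨$⟩ʳ (π ⟨$⟩ʳ k)
transpose-conj π i j k = by-cases (k ≟ i) (k ≟ j)
  where
  by-cases : Dec (k ≡ i) → Dec (k ≡ j) →
    π ⟨$⟩ʳ (transpose i j ⟨$⟩ʳ k) ≡ transpose (π ⟨$⟩ʳ i) (π ⟨$⟩ʳ j) ⟨$⟩ʳ (π ⟨$⟩ʳ k)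
  by-cases (yes refl) _ =
    trans (cong (π ⟨$⟩ʳ_) (transpose-matchˡ k j)) (sym (transpose-matchˡ (π ⟨$⟩ʳ k) (π ⟨$⟩ʳ j)))
  by-cases (no _) (yes refl) =
    trans (cong (π ⟨$⟩ʳ_) (transpose-matchʳ i k)) (sym (transpose-matchʳ (π ⟨$⟩ʳ i) (π ⟨$⟩ʳ k)))
  by-cases (no k≢i) (no k≢j) =
    trans (cong (π ⟨$⟩ʳ_) (transpose-mismatch k≢i k≢j)) (sym (transpose-mismatch
      (k≢i ∘ permutation-injective π) (k≢j ∘ permutation-injective π)))

-- With θ the restriction of π to Q, the permutation is the product of θ and its conjugate by ν.
sgn-halving : (π ν : Permutation′ n) (Q : Fin n → Set) → (∀ x → Dec (Q x)) →
  (∀ x → Q x → Q (π ⟨$⟩ʳ x)) → (∀ x → Q (π ⟨$⟩ʳ x) → Q x) →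
  (∀ x → ν ⟨$⟩ʳ (ν ⟨$⟩ʳ x) ≡ x) →
  (∀ x → π ⟨$⟩ʳ (ν ⟨$⟩ʳ x) ≡ ν ⟨$⟩ʳ (π ⟨$⟩ʳ x)) →
  (∀ x → Q x → ¬ Q (ν ⟨$⟩ʳ x)) →
  (∀ x → ¬ Q x → ¬ Q (ν ⟨$⟩ʳ x) → π ⟨$⟩ʳ x ≡ x) →
  sgn π ≡ 0ℙ
sgn-halving {n} π ν Q Q? Q⇒ Q⇐ νν πν ¬Qν fixed = begin
  sgn π                                      ≡⟨ sgn-cong {π = π} {ν ∘ₚ θ ∘ₚ ν ∘ₚ θ} π≈ ⟩
  sgn (ν ∘ₚ θ ∘ₚ ν ∘ₚ θ)                     ≡⟨ sgn-cong {π = ν ∘ₚ θ ∘ₚ ν ∘ₚ θ} {(ν ∘ₚ θ) ∘ₚ (ν ∘ₚ θ)} (λ _ → refl) ⟩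
  -- A square is even whatever the parity of its root.
  sgn ((ν ∘ₚ θ) ∘ₚ (ν ∘ₚ θ))                 ≡⟨ sgn-∘ (ν ∘ₚ θ) (ν ∘ₚ θ) ⟩
  sgn (ν ∘ₚ θ) +ℙ sgn (ν ∘ₚ θ)               ≡⟨ ℙ.p+p≡0ℙ (sgn (ν ∘ₚ θ)) ⟩
  0ℙ                                         ∎
  where
  open ≡-Reasoning
  restrict : (f : Fin n → Fin n) → Fin n → Fin n
  restrict f x with Q? x
  ... | yes _ = f x
  ... | no _  = x
  restrict-yes : ∀ {f x} → Q x → restrict f x ≡ f x
  restrict-yes {f} {x} q with Q? x
  ... | yes _ = refl
  ... | no ¬q = contradiction q ¬q
  restrict-no : ∀ {f x} → ¬ Q x → restrict f x ≡ x
  restrict-no {f} {x} ¬q with Q? x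
  ... | yes q = contradiction q ¬q
  ... | no _  = refl
  θ-inverse : ∀ {f g} → (∀ {x} → Q x → Q (g x)) → (∀ x → f (g x) ≡ x) →
              ∀ x → restrict f (restrict g x) ≡ x
  θ-inverse {f} {g} g-Q fg x with Q? x
  ... | yes q = trans (restrict-yes (g-Q q)) (fg x)
  ... | no ¬q = restrict-no ¬q
  θ : Permutation′ n
  θ = permutation (restrict (π ⟨$⟩ʳ_)) (restrict (π ⟨$⟩ˡ_))
    (θ-inverse (λ {x} q → Q⇐ _ (subst Q (sym (inverseʳ π)) q)) (λ _ → inverseʳ π))
    (θ-inverse (λ {x} q → Q⇒ _ q) (λ _ → inverseˡ π))
  π≈ : ∀ x → π ⟨$⟩ʳ x ≡ θ ⟨$⟩ʳ (ν ⟨$⟩ʳ (θ ⟨$⟩ʳ (ν ⟨$⟩ʳ x)))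
  -- If `ν` sends `x` into `Q`, the first `θ` acts as `π`, and `ν` then leads out of `Q`, so the
  -- second `θ` does nothing. Otherwise the first `θ` does nothing, the two `ν` cancel, and the
  -- second `θ` acts on `x` itself.
  π≈ x with Q? (ν ⟨$⟩ʳ x)
  ... | yes qν = begin
    π ⟨$⟩ʳ x                             ≡⟨ νπν ⟨
    ν ⟨$⟩ʳ (π ⟨$⟩ʳ (ν ⟨$⟩ʳ x))           ≡⟨ restrict-no (λ q → ¬Qν _ (Q⇒ _ qν) q) ⟨
    θ ⟨$⟩ʳ (ν ⟨$⟩ʳ (π ⟨$⟩ʳ (ν ⟨$⟩ʳ x)))  ∎
    where
    νπν : ν ⟨$⟩ʳ (π ⟨$⟩ʳ (ν ⟨$⟩ʳ x)) ≡ π ⟨$⟩ʳ x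
    νπν = trans (cong (ν ⟨$⟩ʳ_) (πν x)) (νν (π ⟨$⟩ʳ x))
  ... | no ¬qν rewrite νν x with Q? x
  ... | yes _ = refl
  ... | no ¬q = fixed x ¬q ¬qν

-- Arithmetic of natural numbers

2∤⇒odd : ∀ n → ¬ (2 ∣ n) → ∃ λ m → n ≡ suc (m * 2)
2∤⇒odd n 2∤n with n % 2 in eq | m%n<n n 2
... | 0 | _ = contradiction (m%n≡0⇒n∣m n 2 eq) 2∤n
... | 1 | _ = n / 2 , trans (m≡m%n+[m/n]*n n 2) (cong (_+ n / 2 * 2) eq)
... | suc (suc _) | s≤s (s≤s ())

n∣n! : ∀ n .{{_ : NonZero n}} → n ∣ n !
n∣n! (suc n) = m∣m*n (n !)

gcd-suc : ∀ n → gcd n (suc n) ≡ 1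
gcd-suc n = coprime⇒gcd≡1 (Coprime.sym (subst (λ m → Coprime m n) (ℕ.+-comm n 1) (coprime-+ (1-coprimeTo n))))

-- The ring ℤ/n on Fin n

module _ (n : ℕ) .{{_ : NonZero n}} where

  private
    infixl 6 _⊕_
    infixl 7 _⊗_
    opaque
      -- The operations are opaque so that ring terms stay symbolic in later equations instead of
      -- unfolding to remainders.
      _⊕_ _⊗_ : Fin n → Fin n → Fin n
      x ⊕ y = (toℕ x + toℕ y) mod n
      x ⊗ y = (toℕ x * toℕ y) mod n
      ⊖_ : Fin n → Fin n
      ⊖ x = (n ∸ toℕ x) mod n

  toℕ-mod : ∀ a → toℕ (a mod n) ≡ a % n
  toℕ-mod a = toℕ-fromℕ< (m%n<n a n)

  mod-cong : ∀ {a b} → a % n ≡ b % n → a mod n ≡ b mod n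
  mod-cong {a} {b} eq = toℕ-injective (trans (toℕ-mod a) (trans eq (sym (toℕ-mod b))))

  mod-toℕ : ∀ x → toℕ x mod n ≡ x
  mod-toℕ x = toℕ-injective (trans (toℕ-mod (toℕ x)) (m<n⇒m%n≡m (toℕ<n x)))

  opaque
    unfolding _⊕_ _⊗_

    toℕ-* : ∀ x y → toℕ (x ⊗ y) ≡ (toℕ x * toℕ y) % n
    toℕ-* x y = toℕ-mod (toℕ x * toℕ y)

    -- Together with `mod-*` this makes reduction a homomorphism from ℕ, through which the semiring
    -- laws are inherited.
    mod-+ : ∀ a b → (a mod n) ⊕ (b mod n) ≡ (a + b) mod n
    mod-+ a b = trans (cong₂ (λ u v → (u + v) mod n) (toℕ-mod a) (toℕ-mod b))
                      (mod-cong (sym (%-distribˡ-+ a b n)))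

    mod-* : ∀ a b → (a mod n) ⊗ (b mod n) ≡ (a * b) mod n
    mod-* a b = trans (cong₂ (λ u v → (u * v) mod n) (toℕ-mod a) (toℕ-mod b))
                      (mod-cong (sym (%-distribˡ-* a b n)))

  private opaque
    unfolding _⊕_ _⊗_

    ⊕-comm : ∀ x y → x ⊕ y ≡ y ⊕ x
    ⊕-comm x y = cong (_mod n) (ℕ.+-comm (toℕ x) (toℕ y))

    ⊗-comm : ∀ x y → x ⊗ y ≡ y ⊗ x
    ⊗-comm x y = cong (_mod n) (ℕ.*-comm (toℕ x) (toℕ y))

    ⊕-assoc : ∀ x y z → (x ⊕ y) ⊕ z ≡ x ⊕ (y ⊕ z)
    ⊕-assoc x y z = begin
      -- `mod-+` expects both summands as remainders. The left one already unfolds to this form, and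
      -- `mod-toℕ` puts `z` into it.
      (x ⊕ y) ⊕ z                       ≡⟨ cong ((x ⊕ y) ⊕_) (mod-toℕ z) ⟨
      (x ⊕ y) ⊕ (toℕ z mod n)           ≡⟨ mod-+ (toℕ x + toℕ y) (toℕ z) ⟩
      (toℕ x + toℕ y + toℕ z) mod n     ≡⟨ cong (_mod n) (ℕ.+-assoc (toℕ x) (toℕ y) (toℕ z)) ⟩
      (toℕ x + (toℕ y + toℕ z)) mod n   ≡⟨ mod-+ (toℕ x) (toℕ y + toℕ z) ⟨
      (toℕ x mod n) ⊕ (y ⊕ z)           ≡⟨ cong (_⊕ (y ⊕ z)) (mod-toℕ x) ⟩
      x ⊕ (y ⊕ z)                       ∎
      where open ≡-Reasoning

    ⊗-assoc : ∀ x y z → (x ⊗ y) ⊗ z ≡ x ⊗ (y ⊗ z)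
    ⊗-assoc x y z = begin
      (x ⊗ y) ⊗ z                       ≡⟨ cong ((x ⊗ y) ⊗_) (mod-toℕ z) ⟨
      (x ⊗ y) ⊗ (toℕ z mod n)           ≡⟨ mod-* (toℕ x * toℕ y) (toℕ z) ⟩
      (toℕ x * toℕ y * toℕ z) mod n     ≡⟨ cong (_mod n) (ℕ.*-assoc (toℕ x) (toℕ y) (toℕ z)) ⟩
      (toℕ x * (toℕ y * toℕ z)) mod n   ≡⟨ mod-* (toℕ x) (toℕ y * toℕ z) ⟨
      (toℕ x mod n) ⊗ (y ⊗ z)           ≡⟨ cong (_⊗ (y ⊗ z)) (mod-toℕ x) ⟩
      x ⊗ (y ⊗ z)                       ∎
      where open ≡-Reasoning

    ⊗-distribˡ-⊕ : ∀ x y z → x ⊗ (y ⊕ z) ≡ x ⊗ y ⊕ x ⊗ z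
    ⊗-distribˡ-⊕ x y z = begin
      x ⊗ (y ⊕ z)                            ≡⟨ cong (_⊗ (y ⊕ z)) (mod-toℕ x) ⟨
      (toℕ x mod n) ⊗ (y ⊕ z)                ≡⟨ mod-* (toℕ x) (toℕ y + toℕ z) ⟩
      (toℕ x * (toℕ y + toℕ z)) mod n        ≡⟨ cong (_mod n) (ℕ.*-distribˡ-+ (toℕ x) (toℕ y) (toℕ z)) ⟩
      (toℕ x * toℕ y + toℕ x * toℕ z) mod n  ≡⟨ mod-+ (toℕ x * toℕ y) (toℕ x * toℕ z) ⟨
      x ⊗ y ⊕ x ⊗ z                          ∎
      where open ≡-Reasoning

    ⊕-identityˡ : ∀ x → (0 mod n) ⊕ x ≡ x
    ⊕-identityˡ x = trans (cong ((0 mod n) ⊕_) (sym (mod-toℕ x))) (trans (mod-+ 0 (toℕ x)) (mod-toℕ x))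

    ⊗-identityˡ : ∀ x → (1 mod n) ⊗ x ≡ x
    ⊗-identityˡ x = trans (cong ((1 mod n) ⊗_) (sym (mod-toℕ x))) (trans (mod-* 1 (toℕ x))
      (trans (cong (_mod n) (ℕ.*-identityˡ (toℕ x))) (mod-toℕ x)))

  mod-n : n mod n ≡ 0 mod n
  mod-n = mod-cong (trans (n%n≡0 n) (sym (m<n⇒m%n≡m (>-nonZero⁻¹ n))))

  private opaque
    unfolding _⊕_ ⊖_

    ⊖-inverseʳ : ∀ x → x ⊕ (⊖ x) ≡ 0 mod n
    ⊖-inverseʳ x = begin
      x ⊕ (⊖ x)                       ≡⟨ cong (_⊕ (⊖ x)) (mod-toℕ x) ⟨
      (toℕ x mod n) ⊕ (⊖ x)           ≡⟨ mod-+ (toℕ x) (n ∸ toℕ x) ⟩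
      (toℕ x + (n ∸ toℕ x)) mod n     ≡⟨ cong (_mod n) (ℕ.m+[n∸m]≡n (ℕ.<⇒≤ (toℕ<n x))) ⟩
      n mod n                         ≡⟨ mod-n ⟩
      0 mod n                         ∎
      where open ≡-Reasoning

  ℤ/ : CommutativeRing 0ℓ 0ℓ
  ℤ/ = record
    { Carrier = Fin n ; _≈_ = _≡_ ; _+_ = _⊕_ ; _*_ = _⊗_ ; -_ = ⊖_ ; 0# = 0 mod n ; 1# = 1 mod n
    ; isCommutativeRing = record
      { isRing = record
        { +-isAbelianGroup = record
          { isGroup = record
            { isMonoid = record
              { isSemigroup = record
                { isMagma = record { isEquivalence = isEquivalence ; ∙-cong = cong₂ _⊕_ }
                ; assoc = ⊕-assoc }
              ; identity = ⊕-identityˡ , λ x → trans (⊕-comm x _) (⊕-identityˡ x) }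
            ; inverse = (λ x → trans (⊕-comm (⊖ x) x) (⊖-inverseʳ x)) , ⊖-inverseʳ
            ; ⁻¹-cong = cong ⊖_ }
          ; comm = ⊕-comm }
        ; *-cong = cong₂ _⊗_
        ; *-assoc = ⊗-assoc
        ; *-identity = ⊗-identityˡ , λ x → trans (⊗-comm x _) (⊗-identityˡ x)
        ; distrib = ⊗-distribˡ-⊕ , λ x y z →
            trans (⊗-comm (y ⊕ z) x) (trans (⊗-distribˡ-⊕ x y z) (cong₂ _⊕_ (⊗-comm x y) (⊗-comm x z))) }
      ; *-comm = ⊗-comm } }

-- The prime field

module PrimeField (p : ℕ) .{{_ : NonZero p}} (prime : Prime p) (p≢2 : p ≢ 2) where

  open CommutativeRing (ℤ/ p) using (commutativeSemiring; semiring; ring; +-commutativeMonoid;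
      -_; 0#; 1#; +-assoc; +-comm; +-identityˡ; +-identityʳ; -‿inverseˡ; -‿inverseʳ;
      *-assoc; *-comm; *-identityˡ; *-identityʳ; zeroˡ; distribˡ; distribʳ)
    renaming (_+_ to infixl 6 _⊕_; _*_ to infixl 7 _⊗_)
  open import Algebra.Properties.CommutativeSemiring.Exp commutativeSemiring
    using (^-homo-*; ^-assocʳ) renaming (_^_ to infixr 8 _^^_)
  open import Algebra.Properties.Ring ring
    using (x∙y⁻¹≈ε⇒x≈y; -‿involutive; +-inverseˡ-unique; -1*x≈-x; -‿distribˡ-*; -‿distribʳ-*;
           -0#≈0#; -‿+-comm; //-rightDividesˡ; //-rightDividesʳ)
  open import Algebra.Properties.Semiring.Mult semiring using () renaming (_×_ to _⋆_)
  private
    module Sum = Algebra.Properties.CommutativeMonoid.Sum +-commutativeMonoid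
    module Binomial = Algebra.Properties.CommutativeSemiring.Binomial commutativeSemiring
  open ≡-Reasoning

  p>2 : 2 < p
  p>2 = ℕ.≤∧≢⇒< (nonTrivial⇒n>1 p {{prime⇒nonTrivial prime}}) (p≢2 ∘ sym)

  mod≢0 : ∀ {k} → .{{NonZero k}} → k < p → k mod p ≢ 0#
  mod≢0 {k} k<p eq = ≢-nonZero⁻¹ k (begin
    k               ≡⟨ m<n⇒m%n≡m k<p ⟨
    k % p           ≡⟨ toℕ-mod p k ⟨
    toℕ (k mod p)   ≡⟨ cong toℕ eq ⟩
    toℕ (0 mod p)   ≡⟨ toℕ-mod p 0 ⟩
    0 % p           ≡⟨ m<n⇒m%n≡m (>-nonZero⁻¹ p) ⟩
    0               ∎)

  1≢0 : 1# ≢ 0#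
  1≢0 = mod≢0 (ℕ.<-trans (s≤s (s≤s z≤n)) p>2)

  -1≢1 : - 1# ≢ 1#
  -1≢1 eq = mod≢0 p>2 (begin
    2 mod p     ≡⟨ mod-+ p 1 1 ⟨
    1# ⊕ 1#     ≡⟨ cong (_⊕ 1#) eq ⟨
    - 1# ⊕ 1#   ≡⟨ -‿inverseˡ 1# ⟩
    0#          ∎)

  ∣⇒mod≡0 : ∀ {k} → p ∣ k → k mod p ≡ 0#
  ∣⇒mod≡0 p∣k = mod-cong p (trans (n∣m⇒m%n≡0 _ p p∣k) (sym (m<n⇒m%n≡m (>-nonZero⁻¹ p))))

  ∣toℕ⇒≡0 : ∀ {x} → p ∣ toℕ x → x ≡ 0#
  ∣toℕ⇒≡0 {x} p∣x = trans (sym (mod-toℕ p x)) (∣⇒mod≡0 p∣x)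

  zero-product : ∀ x y → x ⊗ y ≡ 0# → x ≡ 0# ⊎ y ≡ 0#
  zero-product x y eq with euclidsLemma (toℕ x) (toℕ y) prime (m%n≡0⇒n∣m _ p (begin
    (toℕ x * toℕ y) % p  ≡⟨ toℕ-* p x y ⟨
    toℕ (x ⊗ y)          ≡⟨ cong toℕ eq ⟩
    toℕ (0 mod p)        ≡⟨ toℕ-mod p 0 ⟩
    0 % p                ≡⟨ m<n⇒m%n≡m (>-nonZero⁻¹ p) ⟩
    0                    ∎))
  ... | inj₁ p∣x = inj₁ (∣toℕ⇒≡0 p∣x)
  ... | inj₂ p∣y = inj₂ (∣toℕ⇒≡0 p∣y)

  0^ : ∀ k .{{_ : NonZero k}} → 0# ^^ k ≡ 0#
  0^ (suc k) = zeroˡ _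

  1^ : ∀ k → 1# ^^ k ≡ 1#
  1^ zero    = refl
  1^ (suc k) = trans (*-identityˡ _) (1^ k)

  mod-^ : ∀ a k → (a ^ k) mod p ≡ (a mod p) ^^ k
  mod-^ a zero    = refl
  mod-^ a (suc k) = trans (sym (mod-* p a (a ^ k))) (cong ((a mod p) ⊗_) (mod-^ a k))

  toℕ-^ : ∀ x k → (toℕ x ^ k) mod p ≡ x ^^ k
  toℕ-^ x k = trans (mod-^ (toℕ x) k) (cong (_^^ k) (mod-toℕ p x))

  -- Fermat's little theorem

  p∤k! : ∀ {k} → k < p → ¬ (p ∣ k !)
  p∤k! {zero}  k<p p∣1 = ℕ.<⇒≱ (ℕ.<-trans (s≤s (s≤s z≤n)) p>2) (∣⇒≤ p∣1)
  p∤k! {suc k} k<p p∣k! with euclidsLemma (suc k) (k !) prime p∣k!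
  ... | inj₁ p∣k+1 = ℕ.<⇒≱ k<p (∣⇒≤ p∣k+1)
  ... | inj₂ p∣k!′ = p∤k! (ℕ.<-trans ℕ.≤-refl k<p) p∣k!′

  -- The prime divides p! = (p C k) k! (p - k)! but neither of the two smaller factorials.
  p∣pCk : ∀ {k} → 0 < k → k < p → p ∣ p C k
  p∣pCk {k} 0<k k<p with euclidsLemma (p C k) (k ! * (p ∸ k) !) prime
      (subst (p ∣_) p!≡ (n∣n! p))
    where
    p!≡ : p ! ≡ (p C k) * (k ! * (p ∸ k) !)
    p!≡ = sym (trans (cong (_* (k ! * (p ∸ k) !)) (nCk≡n!/k![n-k]! (ℕ.<⇒≤ k<p)))
      (m/n*n≡m {{k ℕ.!* (p ∸ k) !≢0}} (k![n∸k]!∣n! (ℕ.<⇒≤ k<p))))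
  ... | inj₁ p∣C = p∣C
  ... | inj₂ p∣den with euclidsLemma (k !) ((p ∸ k) !) prime p∣den
  ... | inj₁ p∣k!   = contradiction p∣k! (p∤k! k<p)
  ... | inj₂ p∣p-k! = contradiction p∣p-k! (p∤k! (ℕ.∸-monoʳ-< 0<k (ℕ.<⇒≤ k<p)))

  mod-suc : ∀ k → suc k mod p ≡ (k mod p) ⊕ 1#
  mod-suc k = trans (cong (_mod p) (ℕ.+-comm 1 k)) (sym (mod-+ p k 1))

  ⋆-mod : ∀ k x → k ⋆ x ≡ (k mod p) ⊗ x
  ⋆-mod zero    x = sym (zeroˡ x)
  ⋆-mod (suc k) x = begin
    x ⊕ k ⋆ x                     ≡⟨ cong₂ _⊕_ (*-identityˡ x) (sym (⋆-mod k x)) ⟨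
    1# ⊗ x ⊕ (k mod p) ⊗ x        ≡⟨ distribʳ x 1# (k mod p) ⟨
    (1# ⊕ (k mod p)) ⊗ x          ≡⟨ cong (_⊗ x) (mod-+ p 1 k) ⟩
    (suc k mod p) ⊗ x             ∎

  ∣⇒⋆≡0 : ∀ {k} x → p ∣ k → k ⋆ x ≡ 0#
  ∣⇒⋆≡0 {k} x p∣k = trans (⋆-mod k x) (trans (cong (_⊗ x) (∣⇒mod≡0 p∣k)) (zeroˡ x))

  ∑-ends : ∀ q (t : Fin (suc (suc q)) → Fin p) → (∀ j → t (suc (inject₁ j)) ≡ 0#) →
    Sum.sum t ≡ t zero ⊕ t (fromℕ (suc q))
  ∑-ends q t middle = cong (t zero ⊕_) (begin
    Sum.sum (t ∘ suc)                                              ≡⟨ Sum.sum-init-last (t ∘ suc) ⟩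
    Sum.sum (λ j → t (suc (inject₁ j))) ⊕ t (fromℕ (suc q))        ≡⟨ cong (_⊕ t (fromℕ (suc q))) (Sum.sum-cong-≗ middle) ⟩
    Sum.sum {q} (λ _ → 0#) ⊕ t (fromℕ (suc q))                     ≡⟨ cong (_⊕ t (fromℕ (suc q))) (Sum.sum-replicate-zero q) ⟩
    0# ⊕ t (fromℕ (suc q))                                         ≡⟨ +-identityˡ _ ⟩
    t (fromℕ (suc q))                                              ∎)

  -- In the binomial expansion every term but the first and the last has a coefficient divisible by
  -- `p`.
  frobenius : ∀ x y → (x ⊕ y) ^^ p ≡ x ^^ p ⊕ y ^^ p
  frobenius x y = go p refl
    where
    -- The exponent is generalised so that it can be matched as a successor, the shape that `∑-ends`
    -- requires.
    go : ∀ m → m ≡ p → (x ⊕ y) ^^ m ≡ x ^^ m ⊕ y ^^ m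
    go zero    0≡p = contradiction (sym 0≡p) (≢-nonZero⁻¹ p)
    go (suc q) m≡p = begin
      (x ⊕ y) ^^ m               ≡⟨ Binomial.theorem m x y ⟩
      Sum.sum t                  ≡⟨ ∑-ends q t middle ⟩
      t zero ⊕ t (fromℕ m)       ≡⟨ cong₂ _⊕_ first last ⟩
      y ^^ m ⊕ x ^^ m            ≡⟨ +-comm (y ^^ m) (x ^^ m) ⟩
      x ^^ m ⊕ y ^^ m            ∎
      where
      m = suc q
      t : Fin (suc m) → Fin p
      t = Binomial.binomialTerm x y m
      middle : ∀ j → t (suc (inject₁ j)) ≡ 0#
      middle j = ∣⇒⋆≡0 _ (subst (λ k → p ∣ k C suc (toℕ (inject₁ j))) (sym m≡p)
        (p∣pCk (s≤s z≤n) (subst₂ (λ a b → suc a < b) (sym (toℕ-inject₁ j)) m≡p (s≤s (toℕ<n j)))))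
      first : t zero ≡ y ^^ m
      first = trans (+-identityʳ _) (*-identityˡ (y ^^ m))
      last : t (fromℕ m) ≡ x ^^ m
      last rewrite toℕ-fromℕ q | nCn≡1 m | ℕ.n∸n≡0 q = trans (+-identityʳ _) (*-identityʳ (x ^^ m))

  -- Induction on a natural representative, with `frobenius` splitting off 1 at each step.
  fermat-mod : ∀ k → (k mod p) ^^ p ≡ k mod p
  fermat-mod zero    = 0^ p
  fermat-mod (suc k) = begin
    (suc k mod p) ^^ p            ≡⟨ cong (_^^ p) (mod-suc k) ⟩
    ((k mod p) ⊕ 1#) ^^ p         ≡⟨ frobenius (k mod p) 1# ⟩
    (k mod p) ^^ p ⊕ 1# ^^ p      ≡⟨ cong₂ _⊕_ (fermat-mod k) (1^ p) ⟩
    (k mod p) ⊕ 1#                ≡⟨ mod-suc k ⟨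
    suc k mod p                   ∎

  fermat : ∀ x → x ^^ p ≡ x
  fermat x = subst (λ y → y ^^ p ≡ y) (mod-toℕ p x) (fermat-mod (toℕ x))

  *-cancelˡ : ∀ {x y z} → x ≢ 0# → x ⊗ y ≡ x ⊗ z → y ≡ z
  *-cancelˡ {x} {y} {z} x≢0 eq with zero-product x (y ⊕ - z) (begin
      x ⊗ (y ⊕ - z)           ≡⟨ distribˡ x y (- z) ⟩
      x ⊗ y ⊕ x ⊗ (- z)       ≡⟨ cong₂ _⊕_ eq (sym (-‿distribʳ-* x z)) ⟩
      x ⊗ z ⊕ - (x ⊗ z)       ≡⟨ -‿inverseʳ (x ⊗ z) ⟩
      0#                      ∎)
  ... | inj₁ x≡0   = contradiction x≡0 x≢0
  ... | inj₂ y-z≡0 = x∙y⁻¹≈ε⇒x≈y y z y-z≡0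

  fermat-little : ∀ {x} → x ≢ 0# → x ^^ (p ∸ 1) ≡ 1#
  fermat-little {x} x≢0 = *-cancelˡ x≢0 (begin
    x ⊗ x ^^ (p ∸ 1)    ≡⟨ cong (x ^^_) (ℕ.m+[n∸m]≡n (>-nonZero⁻¹ p)) ⟩
    x ^^ p              ≡⟨ fermat x ⟩
    x                   ≡⟨ *-identityʳ x ⟨
    x ⊗ 1#              ∎)

  recip : Fin p → Fin p
  recip x = x ^^ (p ∸ 2)

  recip-inverse : ∀ {x} → x ≢ 0# → x ⊗ recip x ≡ 1#
  recip-inverse {x} x≢0 = trans (cong (x ^^_) (sym (ℕ.+-∸-assoc 1 (ℕ.<⇒≤ p>2)))) (fermat-little x≢0)

  -- The exponent p - 2 is positive because p > 2; for exponent 0 the power would be 1.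
  recip-0 : recip 0# ≡ 0#
  recip-0 = 0^ (p ∸ 2) {{>-nonZero (ℕ.m<n⇒0<n∸m p>2)}}

  -- Lets every later reciprocal be found by exhibiting an inverse. The equation itself forces `x`
  -- to be nonzero.
  recip-unique : ∀ {x y} → x ⊗ y ≡ 1# → recip x ≡ y
  recip-unique {x} {y} xy≡1 = *-cancelˡ x≢0 (trans (recip-inverse x≢0) (sym xy≡1))
    where
    x≢0 : x ≢ 0#
    x≢0 refl = 1≢0 (trans (sym xy≡1) (zeroˡ y))

  recip-involutive : ∀ x → recip (recip x) ≡ x
  recip-involutive x with x ≟ 0#
  ... | yes refl = trans (cong recip recip-0) recip-0
  ... | no x≢0   = recip-unique (trans (*-comm _ x) (recip-inverse x≢0))

  -- The group generated by σ and δ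

  shift : Fin p → Permutation′ p
  shift c = permutation (_⊕ c) (_⊕ - c) (λ x → //-rightDividesˡ c x) (λ x → //-rightDividesʳ c x)

  δ : Permutation′ p
  δ = permutation recip recip recip-involutive recip-involutive

  ν : Permutation′ p
  ν = permutation -_ -_ -‿involutive -‿involutive

  shift-1-IsSigma : IsSigma p (shift 1#)
  shift-1-IsSigma x = trans (cong (_⊕ 1#) (sym (mod-toℕ p x))) (mod-+ p (toℕ x) 1)

  δ-IsDelta : IsDelta p δ
  δ-IsDelta x = sym (toℕ-^ x (p ∸ 2))

  ⟨σ,δ⟩ : Permutation′ p → Set
  ⟨σ,δ⟩ = ⟨ SigmaDelta p ⟩

  -- A shift by `k mod p` is the `k`-th power of σ.
  shift-mod∈⟨σ,δ⟩ : ∀ k → ⟨σ,δ⟩ (shift (k mod p))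
  shift-mod∈⟨σ,δ⟩ zero    = ext (λ x → sym (+-identityʳ x)) one
  shift-mod∈⟨σ,δ⟩ (suc k) = ext
    (λ x → trans (+-assoc x (k mod p) 1#) (cong (x ⊕_) (sym (mod-suc k))))
    (mul (shift-mod∈⟨σ,δ⟩ k) (gen {π = shift 1#} (inj₁ shift-1-IsSigma)))

  shift∈⟨σ,δ⟩ : ∀ c → ⟨σ,δ⟩ (shift c)
  shift∈⟨σ,δ⟩ c = subst (λ d → ⟨σ,δ⟩ (shift d)) (mod-toℕ p c) (shift-mod∈⟨σ,δ⟩ (toℕ c))

  δ∈⟨σ,δ⟩ : ⟨σ,δ⟩ δ
  δ∈⟨σ,δ⟩ = gen {π = δ} (inj₂ δ-IsDelta)

  -- `∘ₚ` applies its left factor first. Where no denominator vanishes, the word runs through x + 1,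
  -- 1/(x + 1), -x/(x + 1), -(x + 1)/x, -1/x, -x. The exceptional points are 0 and -1.
  g : Permutation′ p
  g = shift 1# ∘ₚ δ ∘ₚ flip (shift 1#) ∘ₚ δ ∘ₚ shift 1# ∘ₚ δ

  g∈⟨σ,δ⟩ : ⟨σ,δ⟩ g
  g∈⟨σ,δ⟩ = mul σ∈ (mul δ∈⟨σ,δ⟩ (mul (inv σ∈) (mul δ∈⟨σ,δ⟩ (mul σ∈ δ∈⟨σ,δ⟩))))
    where σ∈ = shift∈⟨σ,δ⟩ 1#

  recip-1 : recip 1# ≡ 1#
  recip-1 = recip-unique (*-identityʳ 1#)

  recip-neg1 : recip (- 1#) ≡ - 1#
  recip-neg1 = recip-unique (begin
    - 1# ⊗ - 1#     ≡⟨ -‿distribˡ-* 1# (- 1#) ⟨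
    - (1# ⊗ - 1#)   ≡⟨ cong -_ (*-identityˡ (- 1#)) ⟩
    - (- 1#)        ≡⟨ -‿involutive 1# ⟩
    1#              ∎)

  g-0 : g ⟨$⟩ʳ 0# ≡ 1#
  g-0 = begin
    recip (recip (recip (0# ⊕ 1#) ⊕ - 1#) ⊕ 1#)  ≡⟨ cong (λ y → recip (recip (y ⊕ - 1#) ⊕ 1#)) (trans (cong recip (+-identityˡ 1#)) recip-1) ⟩
    recip (recip (1# ⊕ - 1#) ⊕ 1#)               ≡⟨ cong (λ y → recip (y ⊕ 1#)) (trans (cong recip (-‿inverseʳ 1#)) recip-0) ⟩
    recip (0# ⊕ 1#)                              ≡⟨ trans (cong recip (+-identityˡ 1#)) recip-1 ⟩
    1#                                           ∎

  g-neg1 : g ⟨$⟩ʳ - 1# ≡ 0#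
  g-neg1 = begin
    recip (recip (recip (- 1# ⊕ 1#) ⊕ - 1#) ⊕ 1#)  ≡⟨ cong (λ y → recip (recip (y ⊕ - 1#) ⊕ 1#)) (trans (cong recip (-‿inverseˡ 1#)) recip-0) ⟩
    recip (recip (0# ⊕ - 1#) ⊕ 1#)                 ≡⟨ cong (λ y → recip (y ⊕ 1#)) (trans (cong recip (+-identityˡ (- 1#))) recip-neg1) ⟩
    recip (- 1# ⊕ 1#)                              ≡⟨ trans (cong recip (-‿inverseˡ 1#)) recip-0 ⟩
    0#                                             ∎

  g-generic : ∀ {x} → x ≢ 0# → x ≢ - 1# → g ⟨$⟩ʳ x ≡ - x
  g-generic {x} x≢0 x≢-1 = recip-unique (begin
    -- Writing -x as `b ⊗ a` clears both denominators: `b` cancels against `z`, and then `a` against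
    -- `y`.
    (z ⊕ 1#) ⊗ - x             ≡⟨ cong ((z ⊕ 1#) ⊗_) (sym b⊗a) ⟩
    (z ⊕ 1#) ⊗ (b ⊗ a)         ≡⟨ *-assoc (z ⊕ 1#) b a ⟨
    (z ⊕ 1#) ⊗ b ⊗ a           ≡⟨ cong (_⊗ a) (distribʳ b z 1#) ⟩
    (z ⊗ b ⊕ 1# ⊗ b) ⊗ a       ≡⟨ cong (_⊗ a) (cong₂ _⊕_ (trans (*-comm z b) (recip-inverse b≢0)) (*-identityˡ b)) ⟩
    (1# ⊕ b) ⊗ a               ≡⟨ cong (_⊗ a) (trans (+-comm 1# b) (//-rightDividesˡ 1# y)) ⟩
    y ⊗ a                      ≡⟨ y⊗a ⟩
    1#                         ∎)
    where
    a = x ⊕ 1#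
    y = recip a
    b = y ⊕ - 1#
    z = recip b
    y⊗a : y ⊗ a ≡ 1#
    y⊗a = trans (*-comm y a) (recip-inverse (x≢-1 ∘ +-inverseˡ-unique x 1#))
    b⊗a : b ⊗ a ≡ - x
    b⊗a = begin
      (y ⊕ - 1#) ⊗ a         ≡⟨ distribʳ a y (- 1#) ⟩
      y ⊗ a ⊕ - 1# ⊗ a       ≡⟨ cong₂ _⊕_ y⊗a (-1*x≈-x a) ⟩
      1# ⊕ - (x ⊕ 1#)        ≡⟨ cong (1# ⊕_) (-‿+-comm x 1#) ⟨
      1# ⊕ (- x ⊕ - 1#)      ≡⟨ +-comm 1# (- x ⊕ - 1#) ⟩
      - x ⊕ - 1# ⊕ 1#        ≡⟨ //-rightDividesˡ 1# (- x) ⟩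
      - x                    ∎
    b≢0 : b ≢ 0#
    b≢0 b≡0 = x≢0 (begin
      x              ≡⟨ -‿involutive x ⟨
      - (- x)        ≡⟨ cong -_ b⊗a ⟨
      - (b ⊗ a)      ≡⟨ cong (λ t → - (t ⊗ a)) b≡0 ⟩
      - (0# ⊗ a)     ≡⟨ cong -_ (zeroˡ a) ⟩
      - 0#           ≡⟨ -0#≈0# ⟩
      0#             ∎)

  g≈ : ∀ x → g ⟨$⟩ʳ x ≡ - (transpose 0# (- 1#) ⟨$⟩ʳ x)
  g≈ x = by-cases (x ≟ 0#) (x ≟ - 1#)
    where
    by-cases : Dec (x ≡ 0#) → Dec (x ≡ - 1#) → g ⟨$⟩ʳ x ≡ - (transpose 0# (- 1#) ⟨$⟩ʳ x)
    by-cases (yes refl) _ = trans g-0 (sym (trans (cong -_ (transpose-matchˡ 0# (- 1#))) (-‿involutive 1#)))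
    by-cases (no _) (yes refl) = trans g-neg1 (sym (trans (cong -_ (transpose-matchʳ 0# (- 1#))) -0#≈0#))
    by-cases (no x≢0) (no x≢-1) = trans (g-generic x≢0 x≢-1) (cong -_ (sym (transpose-mismatch x≢0 x≢-1)))

  -- Evenness of shifts

  p-odd : ∃ λ m → p ≡ suc (m * 2)
  p-odd = 2∤⇒odd p λ 2∣p → case prime⇒irreducible prime 2∣p of λ where
    (inj₁ ())
    (inj₂ 2≡p) → p≢2 (sym 2≡p)

  -- For p = 2m + 1 the inverse of 2 is m + 1, since 2(m + 1) = p + 1.
  halve : ∀ c → ∃ λ h → h ⊕ h ≡ c
  halve c with m , p≡ ← p-odd = h , (begin
    c ⊗ (suc m mod p) ⊕ c ⊗ (suc m mod p)      ≡⟨ distribˡ c _ _ ⟨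
    c ⊗ ((suc m mod p) ⊕ (suc m mod p))        ≡⟨ cong (c ⊗_) (mod-+ p (suc m) (suc m)) ⟩
    c ⊗ ((suc m + suc m) mod p)                ≡⟨ cong (λ t → c ⊗ (t mod p)) 2m+2≡ ⟩
    c ⊗ (suc p mod p)                          ≡⟨ cong (c ⊗_) (mod-suc p) ⟩
    c ⊗ ((p mod p) ⊕ 1#)                       ≡⟨ cong (λ t → c ⊗ (t ⊕ 1#)) (mod-n p) ⟩
    c ⊗ (0# ⊕ 1#)                              ≡⟨ cong (c ⊗_) (+-identityˡ 1#) ⟩
    c ⊗ 1#                                     ≡⟨ *-identityʳ c ⟩
    c                                          ∎)
    where
    h = c ⊗ (suc m mod p)
    2m+2≡ : suc m + suc m ≡ suc p
    2m+2≡ = trans (cong suc (ℕ.+-suc m m)) (cong suc (trans (cong suc (trans (cong (m +_) (sym (ℕ.+-identityʳ m))) (ℕ.*-comm 2 m))) (sym p≡)))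

  sgn-shift : ∀ c → sgn (shift c) ≡ 0ℙ
  sgn-shift c with h , h+h≡c ← halve c = begin
    sgn (shift c)               ≡⟨ sgn-cong {π = shift c} {shift h ∘ₚ shift h} (λ x → trans (cong (x ⊕_) (sym h+h≡c)) (sym (+-assoc x h h))) ⟩
    sgn (shift h ∘ₚ shift h)    ≡⟨ sgn-∘ (shift h) (shift h) ⟩
    sgn (shift h) +ℙ sgn (shift h)  ≡⟨ ℙ.p+p≡0ℙ (sgn (shift h)) ⟩
    0ℙ                          ∎

  -- Membership and evenness travel together, so that `cosets` tells the parity in each of its
  -- alternatives.
  Even⟨σ,δ⟩ : Permutation′ p → Set
  Even⟨σ,δ⟩ π = ⟨σ,δ⟩ π × sgn π ≡ 0ℙ

  even-one : Even⟨σ,δ⟩ id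
  even-one = one , sgn-id {p}

  even-mul : ∀ {π ρ} → Even⟨σ,δ⟩ π → Even⟨σ,δ⟩ ρ → Even⟨σ,δ⟩ (π ∘ₚ ρ)
  even-mul {π} {ρ} (π∈ , π-even) (ρ∈ , ρ-even) =
    mul π∈ ρ∈ , trans (sgn-∘ π ρ) (cong₂ _+ℙ_ π-even ρ-even)

  even-inv : ∀ {π} → Even⟨σ,δ⟩ π → Even⟨σ,δ⟩ (flip π)
  even-inv {π} (π∈ , π-even) = inv π∈ , trans (sgn-flip π) π-even

  even-ext : ∀ {π ρ} → (∀ i → π ⟨$⟩ʳ i ≡ ρ ⟨$⟩ʳ i) → Even⟨σ,δ⟩ π → Even⟨σ,δ⟩ ρ
  even-ext {π} {ρ} π≈ρ (π∈ , π-even) = ext π≈ρ π∈ , trans (sym (sgn-cong {π = π} {ρ} π≈ρ)) π-even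

  even-shift : ∀ c → Even⟨σ,δ⟩ (shift c)
  even-shift c = shift∈⟨σ,δ⟩ c , sgn-shift c

  -- Equivalence of all transpositions

  infix 4 _~_
  -- Evenness of these products is propagated from `~-base`, so only one transposition, `s`, needs
  -- its parity computed.
  _~_ : Fin p × Fin p → Fin p × Fin p → Set
  s ~ t = Even⟨σ,δ⟩ (transpose (proj₁ s) (proj₂ s) ∘ₚ transpose (proj₁ t) (proj₂ t))

  ~-refl : ∀ s → s ~ s
  ~-refl (i , j) = even-ext {id} {transpose i j ∘ₚ transpose i j}
    (λ x → sym (transpose-involutive i j x)) even-one

  ~-sym : ∀ s t → s ~ t → t ~ s
  ~-sym (i , j) (k , l) s~t = even-ext {flip (transpose i j ∘ₚ transpose k l)} {transpose k l ∘ₚ transpose i j}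
    (λ x → trans (transpose-comm j i (transpose l k ⟨$⟩ʳ x)) (cong (transpose i j ⟨$⟩ʳ_) (transpose-comm l k x)))
    (even-inv {transpose i j ∘ₚ transpose k l} s~t)

  ~-trans : ∀ s t u → s ~ t → t ~ u → s ~ u
  ~-trans (i , j) (k , l) (m , n) s~t t~u = even-ext
    {(transpose i j ∘ₚ transpose k l) ∘ₚ (transpose k l ∘ₚ transpose m n)} {transpose i j ∘ₚ transpose m n}
    (λ x → cong (transpose m n ⟨$⟩ʳ_) (transpose-involutive k l (transpose i j ⟨$⟩ʳ x)))
    (even-mul {transpose i j ∘ₚ transpose k l} {transpose k l ∘ₚ transpose m n} s~t t~u)

  ~-swap : ∀ i j t → (i , j) ~ t → (j , i) ~ t
  ~-swap i j (k , l) s~t = even-ext {transpose i j ∘ₚ transpose k l} {transpose j i ∘ₚ transpose k l}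
    (λ x → cong (transpose k l ⟨$⟩ʳ_) (transpose-comm i j x)) s~t

  ~-shift : ∀ c i j k l → (i , j) ~ (k , l) → (i ⊕ c , j ⊕ c) ~ (k ⊕ c , l ⊕ c)
  ~-shift c i j k l s~t = even-ext {flip (shift c) ∘ₚ (transpose i j ∘ₚ transpose k l) ∘ₚ shift c}
    {transpose (i ⊕ c) (j ⊕ c) ∘ₚ transpose (k ⊕ c) (l ⊕ c)} conj
    (even-mul {flip (shift c)} {(transpose i j ∘ₚ transpose k l) ∘ₚ shift c} (even-inv {shift c} (even-shift c))
      (even-mul {transpose i j ∘ₚ transpose k l} {shift c} s~t (even-shift c)))
    where
    conj : ∀ x → (transpose k l ⟨$⟩ʳ (transpose i j ⟨$⟩ʳ (x ⊕ - c))) ⊕ c ≡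
      transpose (k ⊕ c) (l ⊕ c) ⟨$⟩ʳ (transpose (i ⊕ c) (j ⊕ c) ⟨$⟩ʳ x)
    conj x = begin
      (transpose k l ⟨$⟩ʳ (transpose i j ⟨$⟩ʳ (x ⊕ - c))) ⊕ c
        ≡⟨ transpose-conj (shift c) k l (transpose i j ⟨$⟩ʳ (x ⊕ - c)) ⟩
      transpose (k ⊕ c) (l ⊕ c) ⟨$⟩ʳ ((transpose i j ⟨$⟩ʳ (x ⊕ - c)) ⊕ c)
        ≡⟨ cong (transpose (k ⊕ c) (l ⊕ c) ⟨$⟩ʳ_) (transpose-conj (shift c) i j (x ⊕ - c)) ⟩
      transpose (k ⊕ c) (l ⊕ c) ⟨$⟩ʳ (transpose (i ⊕ c) (j ⊕ c) ⟨$⟩ʳ (x ⊕ - c ⊕ c))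
        ≡⟨ cong (λ y → transpose (k ⊕ c) (l ⊕ c) ⟨$⟩ʳ (transpose (i ⊕ c) (j ⊕ c) ⟨$⟩ʳ y)) (//-rightDividesˡ c x) ⟩
      transpose (k ⊕ c) (l ⊕ c) ⟨$⟩ʳ (transpose (i ⊕ c) (j ⊕ c) ⟨$⟩ʳ x) ∎

  -- For transpositions u, v, w the product (uv)(uw) is (uvu)w, and uvu is again a transposition.
  ~-conj : ∀ a b i j t → (a , b) ~ (i , j) → (a , b) ~ t →
    (transpose a b ⟨$⟩ʳ i , transpose a b ⟨$⟩ʳ j) ~ t
  ~-conj a b i j (k , l) u~v u~t = even-ext {(u ∘ₚ transpose i j) ∘ₚ (u ∘ₚ transpose k l)}
    {transpose (u ⟨$⟩ʳ i) (u ⟨$⟩ʳ j) ∘ₚ transpose k l}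
    (λ x → cong (transpose k l ⟨$⟩ʳ_) (trans (transpose-conj u i j (u ⟨$⟩ʳ x))
      (cong (transpose (u ⟨$⟩ʳ i) (u ⟨$⟩ʳ j) ⟨$⟩ʳ_) (transpose-involutive a b x))))
    (even-mul {u ∘ₚ transpose i j} {u ∘ₚ transpose k l} u~v u~t)
    where u = transpose a b

  -- In the square of `g`, conjugation by negation turns one factor (0 -1) into (0 1), and the two
  -- negations cancel. Being a square, it is even.
  ~-base : (0# , - 1#) ~ (0# , 1#)
  ~-base = even-ext {g ∘ₚ g} {transpose 0# (- 1#) ∘ₚ transpose 0# 1#} g²≈
    (mul g∈⟨σ,δ⟩ g∈⟨σ,δ⟩ , trans (sgn-∘ g g) (ℙ.p+p≡0ℙ (sgn g)))
    where
    g²≈ : ∀ x → g ⟨$⟩ʳ (g ⟨$⟩ʳ x) ≡ transpose 0# 1# ⟨$⟩ʳ (transpose 0# (- 1#) ⟨$⟩ʳ x)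
    g²≈ x = begin
      g ⟨$⟩ʳ (g ⟨$⟩ʳ x)                        ≡⟨ g≈ (g ⟨$⟩ʳ x) ⟩
      - (τ ⟨$⟩ʳ (g ⟨$⟩ʳ x))                    ≡⟨ cong (λ y → - (τ ⟨$⟩ʳ y)) (g≈ x) ⟩
      - (τ ⟨$⟩ʳ (- (τ ⟨$⟩ʳ x)))                ≡⟨ transpose-conj ν 0# (- 1#) (- (τ ⟨$⟩ʳ x)) ⟩
      transpose (- 0#) (- (- 1#)) ⟨$⟩ʳ (- (- (τ ⟨$⟩ʳ x)))
        ≡⟨ cong₂ (λ a b → transpose a b ⟨$⟩ʳ (- (- (τ ⟨$⟩ʳ x)))) -0#≈0# (-‿involutive 1#) ⟩
      transpose 0# 1# ⟨$⟩ʳ (- (- (τ ⟨$⟩ʳ x)))   ≡⟨ cong (transpose 0# 1# ⟨$⟩ʳ_) (-‿involutive (τ ⟨$⟩ʳ x)) ⟩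
      transpose 0# 1# ⟨$⟩ʳ (τ ⟨$⟩ʳ x)           ∎
      where τ = transpose 0# (- 1#)

  -- `~-base` shifted by k + 1 links the pair (k + 1, k) to the pair (k + 1, k + 2).
  ~-consecutive : ∀ k → (k mod p , suc k mod p) ~ (0# , 1#)
  ~-consecutive zero    = ~-refl (0# , 1#)
  ~-consecutive (suc k) = ~-trans (suc k mod p , suc (suc k) mod p) (suc k mod p , k mod p) (0# , 1#)
    (~-sym (suc k mod p , k mod p) (suc k mod p , suc (suc k) mod p)
      (subst₂ _~_ (cong₂ _,_ (+-identityˡ _) eq₁) (cong₂ _,_ (+-identityˡ _) eq₂)
        (~-shift (suc k mod p) 0# (- 1#) 0# 1# ~-base)))
    (~-swap (k mod p) (suc k mod p) (0# , 1#) (~-consecutive k))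
    where
    eq₁ : - 1# ⊕ (suc k mod p) ≡ k mod p
    eq₁ = trans (+-comm (- 1#) _) (trans (cong (_⊕ - 1#) (mod-suc k)) (//-rightDividesʳ 1# (k mod p)))
    eq₂ : 1# ⊕ (suc k mod p) ≡ suc (suc k) mod p
    eq₂ = mod-+ p 1 (suc k)

  -- Conjugating (0, k + 1) by (k + 1, k + 2) gives (0, k + 2). The bound keeps k + 1 and k + 2 away
  -- from 0 modulo `p`, so that 0 stays fixed.
  ~-star : ∀ k → suc k < p → (0# , suc k mod p) ~ (0# , 1#)
  ~-star zero    _     = ~-refl (0# , 1#)
  ~-star (suc k) 2+k<p = subst (_~ (0# , 1#))
    (cong₂ _,_ (transpose-mismatch (mod≢0 1+k<p ∘ sym) (mod≢0 2+k<p ∘ sym))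
               (transpose-matchˡ (suc k mod p) (suc (suc k) mod p)))
    (~-conj (suc k mod p) (suc (suc k) mod p) 0# (suc k mod p) (0# , 1#)
      (~-trans (suc k mod p , suc (suc k) mod p) (0# , 1#) (0# , suc k mod p)
        (~-consecutive (suc k))
        (~-sym (0# , suc k mod p) (0# , 1#) (~-star k 1+k<p)))
      (~-consecutive (suc k)))
    where
    1+k<p : suc k < p
    1+k<p = ℕ.<-trans ℕ.≤-refl 2+k<p

  ~-0 : ∀ {x} → x ≢ 0# → (0# , x) ~ (0# , 1#)
  ~-0 {x} x≢0 with toℕ x in eq | toℕ<n x
  ... | zero  | _   = contradiction (trans (sym (mod-toℕ p x)) (cong (_mod p) eq)) x≢0
  ... | suc k | k<p = subst (λ y → (0# , y) ~ (0# , 1#))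
    (trans (cong (_mod p) (sym eq)) (mod-toℕ p x)) (~-star k k<p)

  -- The star relation for (0, j - i), shifted by `i`, links (i, j) to the consecutive pair (i, i +
  -- 1).
  ~-all : ∀ {i j} → i ≢ j → (i , j) ~ (0# , 1#)
  ~-all {i} {j} i≢j = ~-trans (i , j) (i , 1# ⊕ i) (0# , 1#)
    (subst₂ _~_ (cong₂ _,_ (+-identityˡ i) (//-rightDividesˡ i j)) (cong (_, 1# ⊕ i) (+-identityˡ i))
      (~-shift i 0# (j ⊕ - i) 0# 1# (~-0 (i≢j ∘ sym ∘ x∙y⁻¹≈ε⇒x≈y j i))))
    (subst (_~ (0# , 1#)) (cong₂ _,_ (mod-toℕ p i)
      (trans (mod-suc (toℕ i)) (trans (cong (_⊕ 1#) (mod-toℕ p i)) (+-comm i 1#))))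
      (~-consecutive (toℕ i)))

  -- Two cosets of the even elements, and the alternating group

  s : Permutation′ p
  s = transpose 0# 1#

  -- Each proper transposition is equivalent to `s`, so prepending it exchanges the alternatives.
  -- The list may also contain pairs (i, i), which change nothing.
  cosets-eval : ∀ ts → Even⟨σ,δ⟩ (eval ts) ⊎ Even⟨σ,δ⟩ (s ∘ₚ eval ts)
  cosets-eval [] = inj₁ even-one
  cosets-eval ((i , j) ∷ ts) with i ≟ j | cosets-eval ts
  ... | yes refl | inj₁ ts∈ = inj₁ (even-ext {eval ts} {transpose i i ∘ₚ eval ts}
    (λ x → cong (eval ts ⟨$⟩ʳ_) (sym (transpose-refl i x))) ts∈)
  ... | yes refl | inj₂ sts∈ = inj₂ (even-ext {s ∘ₚ eval ts} {s ∘ₚ transpose i i ∘ₚ eval ts}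
    (λ x → cong (eval ts ⟨$⟩ʳ_) (sym (transpose-refl i (s ⟨$⟩ʳ x)))) sts∈)
  ... | no i≢j | inj₁ ts∈ = inj₂ (even-mul {s ∘ₚ transpose i j} {eval ts}
    (~-sym (i , j) (0# , 1#) (~-all i≢j)) ts∈)
  ... | no i≢j | inj₂ sts∈ = inj₁ (even-ext {(transpose i j ∘ₚ s) ∘ₚ (s ∘ₚ eval ts)} {transpose i j ∘ₚ eval ts}
    (λ x → cong (eval ts ⟨$⟩ʳ_) (transpose-involutive 0# 1# (transpose i j ⟨$⟩ʳ x)))
    (even-mul {transpose i j ∘ₚ s} {s ∘ₚ eval ts} (~-all i≢j) sts∈))

  cosets : ∀ π → Even⟨σ,δ⟩ π ⊎ Even⟨σ,δ⟩ (s ∘ₚ π)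
  cosets π with cosets-eval (decompose π)
  ... | inj₁ e∈  = inj₁ (even-ext {eval (decompose π)} {π} (eval-decompose π) e∈)
  ... | inj₂ se∈ = inj₂ (even-ext {s ∘ₚ eval (decompose π)} {s ∘ₚ π} (λ x → eval-decompose π (s ⟨$⟩ʳ x)) se∈)

  toℕ-small : ∀ {k} → k < p → toℕ (k mod p) ≡ k
  toℕ-small {k} k<p = trans (toℕ-mod p k) (m<n⇒m%n≡m k<p)

  sgn-s : sgn s ≡ 1ℙ
  sgn-s = sgn-transpose-0-1 0# 1# (toℕ-small (>-nonZero⁻¹ p)) (toℕ-small (ℕ.<-trans (s≤s (s≤s z≤n)) p>2))

  -- As `s` is odd, an even `π` cannot fall under the second alternative of `cosets`.
  Even⇒⟨σ,δ⟩ : ∀ {π} → sgn π ≡ 0ℙ → ⟨σ,δ⟩ π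
  Even⇒⟨σ,δ⟩ {π} π-even with cosets π
  ... | inj₁ (π∈ , _)       = π∈
  ... | inj₂ (_ , sπ-even) = contradiction (begin
    1ℙ                  ≡⟨ cong₂ _+ℙ_ sgn-s π-even ⟨
    sgn s +ℙ sgn π      ≡⟨ sgn-∘ s π ⟨
    sgn (s ∘ₚ π)        ≡⟨ sπ-even ⟩
    0ℙ                  ∎) λ ()

  -- Negation and the full symmetric group for p ≡ 1 (mod 4)

  opposite-⊕-1 : ∀ x → opposite x ⊕ 1# ≡ - x
  opposite-⊕-1 x = +-inverseˡ-unique (opposite x ⊕ 1#) x (begin
    opposite x ⊕ 1# ⊕ x
      ≡⟨ cong₂ (λ a b → a ⊕ 1# ⊕ b) (mod-toℕ p (opposite x)) (mod-toℕ p x) ⟨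
    (toℕ (opposite x) mod p) ⊕ 1# ⊕ (toℕ x mod p)
      ≡⟨ cong (_⊕ (toℕ x mod p)) (mod-+ p (toℕ (opposite x)) 1) ⟩
    ((toℕ (opposite x) + 1) mod p) ⊕ (toℕ x mod p)
      ≡⟨ mod-+ p (toℕ (opposite x) + 1) (toℕ x) ⟩
    (toℕ (opposite x) + 1 + toℕ x) mod p
      ≡⟨ cong (_mod p) (begin
        toℕ (opposite x) + 1 + toℕ x      ≡⟨ ℕ.+-assoc (toℕ (opposite x)) 1 (toℕ x) ⟩
        toℕ (opposite x) + suc (toℕ x)    ≡⟨ cong (_+ suc (toℕ x)) (opposite-prop x) ⟩
        p ∸ suc (toℕ x) + suc (toℕ x)     ≡⟨ ℕ.m∸n+n≡m (toℕ<n x) ⟩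
        p                                 ∎) ⟩
    p mod p
      ≡⟨ mod-n p ⟩
    0# ∎)

  -- `opposite` is x ↦ p - 1 - x, so negation is the reversal followed by a shift, and both are even
  -- here.
  sgn-ν : p % 4 ≡ 1 → sgn ν ≡ 0ℙ
  sgn-ν p%4≡1 = begin
    sgn ν                                 ≡⟨ sgn-cong {π = ν} {reverse ∘ₚ shift 1#} (sym ∘ opposite-⊕-1) ⟩
    sgn (reverse ∘ₚ shift 1#)             ≡⟨ sgn-∘ reverse (shift 1#) ⟩
    sgn (reverse {p}) +ℙ sgn (shift 1#)   ≡⟨ cong₂ _+ℙ_ sgn-reverseₚ (sgn-shift 1#) ⟩
    0ℙ                                    ∎
    where
    sgn-reverseₚ : sgn (reverse {p}) ≡ 0ℙ
    sgn-reverseₚ = subst (λ n → sgn (reverse {n}) ≡ 0ℙ)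
      (sym (trans (m≡m%n+[m/n]*n p 4) (cong (_+ p / 4 * 4) p%4≡1))) (sgn-reverse (p / 4))

  all∈⟨σ,δ⟩ : p % 4 ≡ 1 → ∀ π → ⟨σ,δ⟩ π
  all∈⟨σ,δ⟩ p%4≡1 π with cosets π
  ... | inj₁ (π∈ , _)  = π∈
  ... | inj₂ (sπ∈ , _) = ext {π = s ∘ₚ s ∘ₚ π} {π} (λ x → cong (π ⟨$⟩ʳ_) (transpose-involutive 0# 1# x)) (mul s∈ sπ∈)
    where
    τ : Permutation′ p
    τ = transpose 0# (- 1#)
    τ∈ : ⟨σ,δ⟩ τ
    -- `g` is `τ` followed by negation, which is even and hence available to cancel it.
    τ∈ = ext {π = g ∘ₚ ν} {τ} (λ x → trans (cong -_ (g≈ x)) (-‿involutive (τ ⟨$⟩ʳ x)))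
      (mul g∈⟨σ,δ⟩ (Even⇒⟨σ,δ⟩ {ν} (sgn-ν p%4≡1)))
    s∈ : ⟨σ,δ⟩ s
    -- `~-base` supplies the product of `τ` and `s`, from which `τ` is removed.
    s∈ = ext {π = τ ∘ₚ τ ∘ₚ s} {s} (λ x → cong (s ⟨$⟩ʳ_) (transpose-involutive 0# (- 1#) x))
      (mul τ∈ (proj₁ ~-base))

  -- Power maps for p ≡ 3 (mod 4)

  neg-^-even : ∀ k x → (- x) ^^ (k * 2) ≡ x ^^ (k * 2)
  neg-^-even zero    x = refl
  neg-^-even (suc k) x = begin
    - x ⊗ (- x ⊗ (- x) ^^ (k * 2))     ≡⟨ cong (λ y → - x ⊗ (- x ⊗ y)) (neg-^-even k x) ⟩
    - x ⊗ (- x ⊗ x ^^ (k * 2))         ≡⟨ -‿distribˡ-* x _ ⟨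
    - (x ⊗ (- x ⊗ x ^^ (k * 2)))       ≡⟨ cong (λ y → - (x ⊗ y)) (-‿distribˡ-* x _) ⟨
    - (x ⊗ - (x ⊗ x ^^ (k * 2)))       ≡⟨ cong -_ (-‿distribʳ-* x _) ⟨
    - - (x ⊗ (x ⊗ x ^^ (k * 2)))       ≡⟨ -‿involutive _ ⟩
    x ⊗ (x ⊗ x ^^ (k * 2))             ∎

  neg-^-odd : ∀ k x → (- x) ^^ suc (k * 2) ≡ - (x ^^ suc (k * 2))
  neg-^-odd k x = trans (cong (- x ⊗_) (neg-^-even k x)) (sym (-‿distribˡ-* x _))

  square-root-of-1 : ∀ u → u ⊗ u ≡ 1# → u ≡ 1# ⊎ u ≡ - 1#
  square-root-of-1 u u²≡1 with zero-product (u ⊕ - 1#) (u ⊕ 1#) (begin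
      (u ⊕ - 1#) ⊗ (u ⊕ 1#)               ≡⟨ distribʳ (u ⊕ 1#) u (- 1#) ⟩
      u ⊗ (u ⊕ 1#) ⊕ - 1# ⊗ (u ⊕ 1#)      ≡⟨ cong₂ _⊕_ (distribˡ u u 1#) (-1*x≈-x (u ⊕ 1#)) ⟩
      u ⊗ u ⊕ u ⊗ 1# ⊕ - (u ⊕ 1#)         ≡⟨ cong (_⊕ - (u ⊕ 1#)) (cong₂ _⊕_ u²≡1 (*-identityʳ u)) ⟩
      1# ⊕ u ⊕ - (u ⊕ 1#)                 ≡⟨ cong (_⊕ - (u ⊕ 1#)) (+-comm 1# u) ⟩
      u ⊕ 1# ⊕ - (u ⊕ 1#)                 ≡⟨ -‿inverseʳ (u ⊕ 1#) ⟩
      0#                                  ∎)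
  ... | inj₁ u-1≡0 = inj₁ (x∙y⁻¹≈ε⇒x≈y u 1# u-1≡0)
  ... | inj₂ u+1≡0 = inj₂ (+-inverseˡ-unique u 1# u+1≡0)

  sgn-power : p % 4 ≡ 3 → ∀ e (π : Permutation′ p) → (∀ x → π ⟨$⟩ʳ x ≡ x ^^ suc (e * 2)) → sgn π ≡ 0ℙ
  sgn-power p%4≡3 e π π≡ = sgn-halving π ν Q (λ x → x ^^ m ≟ 1#) Q⇒ Q⇐ -‿involutive πν Qν fixed
    where
    d = suc (e * 2)
    -- This is (p - 1)/2. Its oddness, a consequence of p ≡ 3 (mod 4), makes negation change the
    -- sign of x^m.
    m = suc (p / 4 * 2)
    m+m≡p-1 : m + m ≡ p ∸ 1
    m+m≡p-1 = begin
      m + m                ≡⟨ cong suc (ℕ.+-suc (p / 4 * 2) (p / 4 * 2)) ⟩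
      2 + (p / 4 * 2 + p / 4 * 2) ≡⟨ cong (2 +_) (ℕ.*-distribˡ-+ (p / 4) 2 2) ⟨
      2 + p / 4 * 4        ≡⟨ cong (λ r → r + p / 4 * 4 ∸ 1) p%4≡3 ⟨
      p % 4 + p / 4 * 4 ∸ 1  ≡⟨ cong (_∸ 1) (m≡m%n+[m/n]*n p 4) ⟨
      p ∸ 1                ∎
    Q : Fin p → Set
    Q x = x ^^ m ≡ 1#
    euler : ∀ {x} → x ≢ 0# → x ^^ m ≡ 1# ⊎ x ^^ m ≡ - 1#
    euler {x} x≢0 = square-root-of-1 (x ^^ m) (begin
      x ^^ m ⊗ x ^^ m   ≡⟨ ^-homo-* x m m ⟨
      x ^^ (m + m)      ≡⟨ cong (x ^^_) m+m≡p-1 ⟩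
      x ^^ (p ∸ 1)      ≡⟨ fermat-little x≢0 ⟩
      1#                ∎)
    -- Since `d` is odd, a value 1 or -1 of x^m is left unchanged by raising it to the power `d`.
    -- Hence `π` both preserves and reflects `Q`.
    π-^m : ∀ x → (π ⟨$⟩ʳ x) ^^ m ≡ (x ^^ m) ^^ d
    π-^m x = begin
      (π ⟨$⟩ʳ x) ^^ m   ≡⟨ cong (_^^ m) (π≡ x) ⟩
      (x ^^ d) ^^ m     ≡⟨ ^-assocʳ x d m ⟩
      x ^^ (d * m)      ≡⟨ cong (x ^^_) (ℕ.*-comm d m) ⟩
      x ^^ (m * d)      ≡⟨ ^-assocʳ x m d ⟨
      (x ^^ m) ^^ d     ∎
    Q⇒ : ∀ x → Q x → Q (π ⟨$⟩ʳ x)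
    Q⇒ x q = trans (π-^m x) (trans (cong (_^^ d) q) (1^ d))
    ¬Q0 : ¬ Q 0#
    ¬Q0 q = 1≢0 (trans (sym q) (0^ m))
    π0 : π ⟨$⟩ʳ 0# ≡ 0#
    π0 = trans (π≡ 0#) (0^ d)
    Q⇐ : ∀ x → Q (π ⟨$⟩ʳ x) → Q x
    Q⇐ x q with x ≟ 0#
    ... | yes refl = contradiction (subst Q π0 q) ¬Q0
    ... | no x≢0 with euler x≢0
    ... | inj₁ x^m≡1  = x^m≡1
    ... | inj₂ x^m≡-1 = contradiction (begin
      - 1#                ≡⟨ cong -_ (1^ d) ⟨
      - (1# ^^ d)         ≡⟨ neg-^-odd e 1# ⟨
      (- 1#) ^^ d         ≡⟨ cong (_^^ d) x^m≡-1 ⟨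
      (x ^^ m) ^^ d       ≡⟨ π-^m x ⟨
      (π ⟨$⟩ʳ x) ^^ m     ≡⟨ q ⟩
      1#                  ∎) -1≢1
    πν : ∀ x → π ⟨$⟩ʳ (- x) ≡ - (π ⟨$⟩ʳ x)
    πν x = trans (π≡ (- x)) (trans (neg-^-odd e x) (cong -_ (sym (π≡ x))))
    Qν : ∀ x → Q x → ¬ Q (- x)
    Qν x q qν = -1≢1 (begin
      - 1#            ≡⟨ cong -_ q ⟨
      - (x ^^ m)      ≡⟨ neg-^-odd (p / 4) x ⟨
      (- x) ^^ m      ≡⟨ qν ⟩
      1#              ∎)
    -- By `euler` every nonzero `x` lies in `Q` or has its negative there, so only 0 remains.
    fixed : ∀ x → ¬ Q x → ¬ Q (- x) → π ⟨$⟩ʳ x ≡ x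
    fixed x ¬q ¬qν with x ≟ 0#
    ... | yes refl = π0
    ... | no x≢0 with euler x≢0
    ... | inj₁ x^m≡1  = contradiction x^m≡1 ¬q
    ... | inj₂ x^m≡-1 = contradiction (trans (neg-^-odd (p / 4) x) (trans (cong -_ x^m≡-1) (-‿involutive 1#))) ¬qν

  -- As p - 1 is even, an even `d` would share the factor 2 with it.
  exponent-odd : ∀ {d} → gcd d (p ∸ 1) ≡ 1 → ∃ λ e → d ≡ suc (e * 2)
  exponent-odd {d} coprime = 2∤⇒odd d λ 2∣d →
    >⇒∤ (s≤s (s≤s z≤n)) (subst (2 ∣_) coprime (gcd-greatest 2∣d (2∣p-1 p-odd)))
    where
    2∣p-1 : (∃ λ m → p ≡ suc (m * 2)) → 2 ∣ p ∸ 1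
    2∣p-1 (m , p≡) = divides m (cong (_∸ 1) p≡)

  sgn-PowerShift : p % 4 ≡ 3 → ∀ {π} → PowerShift p π → sgn π ≡ 0ℙ
  sgn-PowerShift p%4≡3 {π} (d , c , _ , _ , coprime , π≡) with e , refl ← exponent-odd {d} coprime = begin
    sgn π                       ≡⟨ sgn-cong {π = π} {ρ ∘ₚ shift c} (λ x → sym (//-rightDividesˡ c (π ⟨$⟩ʳ x))) ⟩
    sgn (ρ ∘ₚ shift c)          ≡⟨ sgn-∘ ρ (shift c) ⟩
    sgn ρ +ℙ sgn (shift c)      ≡⟨ cong₂ _+ℙ_ (sgn-power p%4≡3 e ρ ρ≡) (sgn-shift c) ⟩
    0ℙ                          ∎
    where
    -- Undoing the translation in `π` yields the power map already equipped with its inverse.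
    ρ : Permutation′ p
    ρ = π ∘ₚ flip (shift c)
    ρ≡ : ∀ x → ρ ⟨$⟩ʳ x ≡ x ^^ d
    ρ≡ x = begin
      (π ⟨$⟩ʳ x) ⊕ - c                              ≡⟨ cong (_⊕ - c) (π≡ x) ⟩
      ((toℕ x ^ d + toℕ c) mod p) ⊕ - c             ≡⟨ cong (_⊕ - c) (mod-+ p (toℕ x ^ d) (toℕ c)) ⟨
      ((toℕ x ^ d) mod p) ⊕ (toℕ c mod p) ⊕ - c     ≡⟨ cong₂ (λ a b → a ⊕ b ⊕ - c) (toℕ-^ x d) (mod-toℕ p c) ⟩
      x ^^ d ⊕ c ⊕ - c                              ≡⟨ //-rightDividesʳ c (x ^^ d) ⟩
      x ^^ d                                        ∎

  sgn-⟨PowerShift⟩ : p % 4 ≡ 3 → ∀ {π} → ⟨ PowerShift p ⟩ π → sgn π ≡ 0ℙ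
  sgn-⟨PowerShift⟩ p%4≡3 (gen {π} π∈)           = sgn-PowerShift p%4≡3 {π} π∈
  sgn-⟨PowerShift⟩ p%4≡3 one                    = sgn-id {p}
  sgn-⟨PowerShift⟩ p%4≡3 (mul {π} {ρ} π∈ ρ∈)    = trans (sgn-∘ π ρ)
    (cong₂ _+ℙ_ (sgn-⟨PowerShift⟩ p%4≡3 π∈) (sgn-⟨PowerShift⟩ p%4≡3 ρ∈))
  sgn-⟨PowerShift⟩ p%4≡3 (inv {π} π∈)           = trans (sgn-flip π) (sgn-⟨PowerShift⟩ p%4≡3 π∈)
  sgn-⟨PowerShift⟩ p%4≡3 (ext {π} {ρ} π≈ρ π∈)   = trans (sym (sgn-cong {π = π} {ρ} π≈ρ)) (sgn-⟨PowerShift⟩ p%4≡3 π∈)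

  -- Comparison of the two generating sets

  SigmaDelta⇒PowerShift : ∀ {π} → SigmaDelta p π → PowerShift p π
  SigmaDelta⇒PowerShift (inj₁ π≡) = 1 , 1# , s≤s z≤n , ℕ.∸-monoˡ-≤ 1 p>2 , coprime⇒gcd≡1 (1-coprimeTo (p ∸ 1)) ,
    λ x → trans (π≡ x) (cong (_mod p) (cong₂ _+_ (sym (ℕ.*-identityʳ (toℕ x)))
      (sym (toℕ-small (ℕ.<-trans (s≤s (s≤s z≤n)) p>2)))))
  -- The exponent p - 2 is admissible because consecutive numbers are coprime.
  SigmaDelta⇒PowerShift (inj₂ π≡) = p ∸ 2 , 0# , ℕ.m<n⇒0<n∸m p>2 ,
    ℕ.∸-monoʳ-< (s≤s (s≤s z≤n)) (ℕ.<⇒≤ p>2) ,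
    trans (cong (gcd (p ∸ 2)) (ℕ.+-∸-assoc 1 (ℕ.<⇒≤ p>2))) (gcd-suc (p ∸ 2)) ,
    λ x → trans (π≡ x) (cong (_mod p) (sym (trans (cong (toℕ x ^ (p ∸ 2) +_) (toℕ-small (>-nonZero⁻¹ p)))
      (ℕ.+-identityʳ _))))

⟨⟩-mono : ∀ {n} {S T : Permutation′ n → Set} → (∀ {π} → S π → T π) → ∀ {π} → ⟨ S ⟩ π → ⟨ T ⟩ π
⟨⟩-mono S⊆T (gen {π} π∈)         = gen {π = π} (S⊆T {π} π∈)
⟨⟩-mono S⊆T one                  = one
⟨⟩-mono S⊆T (mul π∈ ρ∈)          = mul (⟨⟩-mono S⊆T π∈) (⟨⟩-mono S⊆T ρ∈)
⟨⟩-mono S⊆T (inv π∈)             = inv (⟨⟩-mono S⊆T π∈)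
⟨⟩-mono S⊆T (ext {π} {ρ} eq π∈)  = ext {π = π} {ρ} eq (⟨⟩-mono S⊆T π∈)

odd-mod-4 : ∀ m → suc (m * 2) % 4 ≡ 1 ⊎ suc (m * 2) % 4 ≡ 3
odd-mod-4 zero          = inj₁ refl
odd-mod-4 (suc zero)    = inj₂ refl
odd-mod-4 (suc (suc m)) with odd-mod-4 m
... | inj₁ eq = inj₁ eq
... | inj₂ eq = inj₂ eq

theorem1p1 : (p : ℕ) .{{_ : NonZero p}} → Prime p → p ≢ 2 →
    ((π : Permutation′ p) → ⟨ SigmaDelta p ⟩ π ⇔ ⟨ PowerShift p ⟩ π)
    × (p % 4 ≡ 1 → (π : Permutation′ p) → ⟨ PowerShift p ⟩ π)
    × (p % 4 ≡ 3 → (π : Permutation′ p) → ⟨ PowerShift p ⟩ π ⇔ Even π)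
theorem1p1 p p-prime p≢2 =
  (λ π → mk⇔ ⊆G (G⊆ residue π)) ,
  (λ p%4≡1 π → ⊆G (all∈⟨σ,δ⟩ p%4≡1 π)) ,
  (λ p%4≡3 π → mk⇔ (λ π∈G → sgn⇒Even {π = π} (sgn-⟨PowerShift⟩ p%4≡3 π∈G))
                   (λ π-even → ⊆G (Even⇒⟨σ,δ⟩ {π} (Even⇒sgn {π = π} π-even))))
  where
  open PrimeField p p-prime p≢2
  ⊆G : ∀ {π} → ⟨ SigmaDelta p ⟩ π → ⟨ PowerShift p ⟩ π
  ⊆G = ⟨⟩-mono (λ {π} → SigmaDelta⇒PowerShift {π})
  residue : p % 4 ≡ 1 ⊎ p % 4 ≡ 3
  residue with m , p≡ ← p-odd = subst (λ n → n % 4 ≡ 1 ⊎ n % 4 ≡ 3) (sym p≡) (odd-mod-4 m)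
  -- No power map is written as a word in σ and δ: either ⟨σ,δ⟩ is everything, or all of G is even
  -- and ⟨σ,δ⟩ contains every even permutation.
  G⊆ : p % 4 ≡ 1 ⊎ p % 4 ≡ 3 → ∀ π → ⟨ PowerShift p ⟩ π → ⟨ SigmaDelta p ⟩ π
  G⊆ (inj₁ p%4≡1) π _   = all∈⟨σ,δ⟩ p%4≡1 π
  G⊆ (inj₂ p%4≡3) π π∈G = Even⇒⟨σ,δ⟩ {π} (sgn-⟨PowerShift⟩ p%4≡3 π∈G)
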